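{- Let $r \geq 3$ and let $\mathcal{H}$ be a friendship $r$-hypergraph on $n \geq r+1$ vertices. Then \[ |E(\mathcal{H})| \leq \frac{2}{r(r+1)}\left\lfloor \frac{(r+1)(3r-4)}{6}\right\rfloor \binom{n}{r} + \frac{4}{r^2(r+1)}\left\lceil \frac{2(r+1)}{3} \right\rceil \binom{n}{r-1}. \] Moreover, if equality holds, then every set of $r-1$ vertices of $\mathcal{H}$ is contained in the same number of hyperedges of $\mathcal{H}$.
   Context: For an $r$-uniform hypergraph $\mathcal{H}$ and a set of vertices $A$, a vertex $u \notin A$ is a friend of $A$ in $\mathcal{H}$ if for every $B \subseteq A$ with $|B| = r-1$, the set $B \cup \{u\}$ is a hyperedge of $\mathcal{H}$. An $r$-uniform hypergraph is a friendship $r$-hypergraph if every set of $r$ vertices has exactly one friend. -}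

module Defs where

open import Data.Nat using (ℕ; zero; suc; _+_; _*_; _∸_; _≤_)
open import Data.Nat.DivMod using (_/_)
open import Data.Bool using (Bool; true; false; if_then_else_)
open import Data.Vec using ([]; _∷_)
open import Data.List using (List; []; _∷_; map; _++_)
open import Data.Nat.ListAction using (sum)
open import Data.Fin using (Fin)
open import Data.Fin.Subset using (Subset; ∣_∣; _∈_; _∉_; _⊆_; _∪_; ⁅_⁆)
open import Data.Product using (Σ; ∃; _×_)
open import Relation.Binary.PropositionalEquality using (_≡_)

allSubsets : (n : ℕ) → List (Subset n)
allSubsets zero    = [] ∷ []
allSubsets (suc n) = map (false ∷_) (allSubsets n) ++ map (true ∷_) (allSubsets n)

countSubsets : {n : ℕ} → (Subset n → Bool) → ℕ
countSubsets {n} P = sum (map (λ s → if P s then 1 else 0) (allSubsets n))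

record Hypergraph (r n : ℕ) : Set where
  field
    isEdge  : Subset n → Bool
    uniform : ∀ (e : Subset n) → isEdge e ≡ true → ∣ e ∣ ≡ r
open Hypergraph public

numEdges : {r n : ℕ} → Hypergraph r n → ℕ
numEdges H = countSubsets (isEdge H)

degree : {r n : ℕ} → Hypergraph r n → Subset n → ℕ
degree H S = countSubsets (λ e → containsB S e)
  where
  andB : Bool → Bool → Bool
  andB true b = b
  andB false _ = false
  impB : Bool → Bool → Bool
  impB true b = b
  impB false _ = true
  subB : {m : ℕ} → Subset m → Subset m → Bool
  subB [] [] = true
  subB (x ∷ xs) (y ∷ ys) = andB (impB x y) (subB xs ys)
  containsB : Subset _ → Subset _ → Bool
  containsB S e = andB (isEdge H e) (subB S e)

IsFriend : {r n : ℕ} → Hypergraph r n → Subset n → Fin n → Set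
IsFriend {r} H A u =
  u ∉ A × (∀ (B : Subset _) → B ⊆ A → ∣ B ∣ ≡ r ∸ 1 → isEdge H (B ∪ ⁅ u ⁆) ≡ true)

IsFriendship : {r n : ℕ} → Hypergraph r n → Set
IsFriendship {r} H =
  ∀ (A : Subset _) → ∣ A ∣ ≡ r →
    Σ (Fin _) (λ u → IsFriend H A u × (∀ v → IsFriend H A v → v ≡ u))

-- ⌊(r+1)(3r-4)/6⌋  (for r ≥ 3, 3r ∸ 4 = 3r - 4)
floorTerm : ℕ → ℕ
floorTerm r = ((r + 1) * (3 * r ∸ 4)) / 6

-- ⌈2(r+1)/3⌉ = ⌊(2(r+1)+2)/3⌋
ceilTerm : ℕ → ℕ
ceilTerm r = (2 * (r + 1) + 2) / 3

{-# OPTIONS --safe #-}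

-- Every hyperedge A, together with its friend, spans a complete set of r + 1 vertices, and this is
-- the only complete (r + 1)-set containing A.  For a complete K and a vertex v outside K, consider
-- the graph on K whose edges are the pairs xy such that K − x − y + v is not a hyperedge.
-- Uniqueness of friends forbids isolated vertices (v would be a second friend of K − x) and
-- isolated edges (x and y would both be friends of K − x − y + v), so this graph has at least
-- 2 (r + 1) / 3 edges and at most ⌊(r + 1)(3r − 4) / 6⌋ of the sets K − x − y + v are hyperedges.
-- Summing over all K and v bounds ∑ d(S)² over the (r − 1)-sets S, where ∑ d(S) = r |E|, and
-- Cauchy–Schwarz gives the bound; in the case of equality it forces d to be constant.
module Submission where

open import Defs
open import Data.Bool using (Bool; true; false; T; not; _∧_; _∨_; if_then_else_)
import Data.Bool.Properties as Bool
open import Data.Fin using (Fin; zero; suc)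
open import Data.Fin.Properties using (all?) renaming (_≟_ to _≟ᵥ_)
open import Data.Fin.Subset using (Subset; ∣_∣; _⊆_; _∪_; ⁅_⁆)
open import Data.Fin.Subset.Properties using (∪-identityʳ; drop-∷-⊆)
open import Data.List using (List; []; _∷_; map; _++_; allFin)
open import Data.List.Membership.Propositional using (_∈_)
open import Data.List.Membership.Propositional.Properties using (∈-map⁺; ∈-++⁺ˡ; ∈-++⁺ʳ; ∈-allFin)
open import Data.List.Properties using (map-∘; map-++; map-cong; map-tabulate)
open import Data.List.Relation.Unary.Any using (here; there)
open import Data.Nat using (ℕ; zero; suc; _+_; _*_; _∸_; _≤_; _≟_; _≡ᵇ_; NonZero; z≤n; s≤s)
open import Data.Nat.Combinatorics using (_C_; nCk+nC[k+1]≡[n+1]C[k+1])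
open import Data.Nat.DivMod using (_/_; m*n/n≡m; /-monoˡ-≤; m≡m%n+[m/n]*n; m%n<n)
open import Data.Nat.ListAction using (sum)
open import Data.Nat.ListAction.Properties using (sum-++)
open import Data.Nat.Properties hiding (_≟_)
open import Data.Nat.Tactic.RingSolver using (solve-∀)
open import Data.Product using (Σ; ∃; _×_; _,_; proj₁; proj₂)
open import Data.Vec using ([]; _∷_; lookup; _[_]≔_; here)
open import Data.Vec.Properties using (lookup∘update; lookup∘update′; lookup⇒[]=; []=⇒lookup)
open import Data.Vec.Properties using ([]≔-idempotent; []≔-commutes; []≔-lookup)
open import Function using (_∘_; id)
open import Relation.Binary.PropositionalEquality
open import Relation.Nullary using (Dec; does; yes; no; contradiction)
open import Relation.Nullary.Decidable using (_×-dec_; _→-dec_; dec-true)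

open ≡-Reasoning

private
  variable
    A B : Set
    n : ℕ

-- Finite sums

∑ : List A → (A → ℕ) → ℕ
∑ xs f = sum (map f xs)

*-swap : ∀ a b c → a * (b * c) ≡ b * (a * c)
*-swap = solve-∀

∑-cong : ∀ (xs : List A) {f g : A → ℕ} → (∀ x → f x ≡ g x) → ∑ xs f ≡ ∑ xs g
∑-cong xs f≗g = cong sum (map-cong f≗g xs)

∑-mono : ∀ (xs : List A) {f g : A → ℕ} → (∀ x → f x ≤ g x) → ∑ xs f ≤ ∑ xs g
∑-mono []       f≤g = z≤n
∑-mono (x ∷ xs) f≤g = +-mono-≤ (f≤g x) (∑-mono xs f≤g)

∑-zero : ∀ (xs : List A) {f : A → ℕ} → (∀ x → f x ≡ 0) → ∑ xs f ≡ 0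
∑-zero []       f≗0 = refl
∑-zero (x ∷ xs) f≗0 = cong₂ _+_ (f≗0 x) (∑-zero xs f≗0)

∑-+ : ∀ (xs : List A) (f g : A → ℕ) → ∑ xs (λ x → f x + g x) ≡ ∑ xs f + ∑ xs g
∑-+ []       f g = refl
∑-+ (x ∷ xs) f g = trans (cong (f x + g x +_) (∑-+ xs f g)) (interchange (f x) (g x) (∑ xs f) (∑ xs g))
  where
  interchange : ∀ a b c d → a + b + (c + d) ≡ a + c + (b + d)
  interchange = solve-∀

∑-*ˡ : ∀ (xs : List A) c (f : A → ℕ) → ∑ xs (λ x → c * f x) ≡ c * ∑ xs f
∑-*ˡ []       c f = sym (*-zeroʳ c)
∑-*ˡ (x ∷ xs) c f = trans (cong (c * f x +_) (∑-*ˡ xs c f)) (sym (*-distribˡ-+ c (f x) (∑ xs f)))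

∑-*ʳ : ∀ (xs : List A) c (f : A → ℕ) → ∑ xs (λ x → f x * c) ≡ ∑ xs f * c
∑-*ʳ xs c f = trans (∑-cong xs λ x → *-comm (f x) c) (trans (∑-*ˡ xs c f) (*-comm c (∑ xs f)))

∑-swap : ∀ (xs : List A) (ys : List B) (f : A → B → ℕ) →
         ∑ xs (λ x → ∑ ys (f x)) ≡ ∑ ys (λ y → ∑ xs λ x → f x y)
∑-swap []       ys f = sym (∑-zero ys λ _ → refl)
∑-swap (x ∷ xs) ys f =
  trans (cong (∑ ys (f x) +_) (∑-swap xs ys f)) (sym (∑-+ ys (f x) λ y → ∑ xs λ x′ → f x′ y))

∑-++ : ∀ (xs ys : List A) (f : A → ℕ) → ∑ (xs ++ ys) f ≡ ∑ xs f + ∑ ys f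
∑-++ xs ys f = trans (cong sum (map-++ f xs ys)) (sum-++ (map f xs) (map f ys))

∑-∈-≤ : ∀ {xs : List A} (f : A → ℕ) {x} → x ∈ xs → f x ≤ ∑ xs f
∑-∈-≤ f (here refl)                = m≤m+n _ _
∑-∈-≤ {xs = y ∷ _} f (there x∈xs) = ≤-trans (∑-∈-≤ f x∈xs) (m≤n+m _ (f y))

-- Slack in one term could not be made up by the others, since `f` stays below `g` everywhere.
∑-tight : ∀ {xs : List A} {f g : A → ℕ} → (∀ x → f x ≤ g x) → ∑ xs g ≤ ∑ xs f →
          ∀ {x} → x ∈ xs → f x ≡ g x
∑-tight {xs = y ∷ xs} {f} {g} f≤g ∑g≤∑f (here refl) =
  ≤-antisym (f≤g y) (+-cancelʳ-≤ (∑ xs g) _ _ (≤-trans ∑g≤∑f (+-monoʳ-≤ (f y) (∑-mono xs f≤g))))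
∑-tight {xs = y ∷ xs} {f} {g} f≤g ∑g≤∑f (there x∈xs) =
  ∑-tight f≤g (+-cancelˡ-≤ (f y) _ _ (≤-trans (+-monoˡ-≤ (∑ xs g) (f≤g y)) ∑g≤∑f)) x∈xs

-- Cauchy-Schwarz with its case of equality

2xy-suc : ∀ x y → 2 * (suc x * suc y) ≡ 2 * (x * y) + (2 * x + 2 * y + 2)
2xy-suc = solve-∀

x²+y²-suc : ∀ x y → suc x * suc x + suc y * suc y ≡ x * x + y * y + (2 * x + 2 * y + 2)
x²+y²-suc = solve-∀

-- Raising both variables by one adds the same amount to both sides, so induction descends until one
-- variable is zero; this avoids squaring a difference in ℕ.
cauchy-term : ∀ x y → 2 * (x * y) ≤ x * x + y * y
cauchy-term zero    y       = z≤n
cauchy-term (suc x) zero    = ≤-trans (≤-reflexive (cong (2 *_) (*-zeroʳ x))) z≤n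
cauchy-term (suc x) (suc y) =
  subst₂ _≤_ (sym (2xy-suc x y)) (sym (x²+y²-suc x y)) (+-monoˡ-≤ _ (cauchy-term x y))

cauchy-term-tight : ∀ x y → 2 * (x * y) ≡ x * x + y * y → x ≡ y
cauchy-term-tight zero    zero    _  = refl
cauchy-term-tight (suc x) zero    eq with trans (sym (cong (2 *_) (*-zeroʳ x))) eq
... | ()
cauchy-term-tight (suc x) (suc y) eq =
  cong suc (cauchy-term-tight x y (+-cancelʳ-≡ _ _ _ (trans (sym (2xy-suc x y)) (trans eq (x²+y²-suc x y)))))

-- Two double sums over pairs are compared, whose difference is the sum of w x · w y · (d x - d y)².
-- The weights later single out the sets of one size among all subsets.
module CauchySchwarz (xs : List A) (w d : A → ℕ) where

  mass = ∑ xs w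
  first = ∑ xs λ x → w x * d x
  second = ∑ xs λ x → w x * (d x * d x)

  private
    mixed square : A → A → ℕ
    mixed x y = w x * w y * (2 * (d x * d y))
    square x y = w x * w y * (d x * d x + d y * d y)

    ∑∑-mixed : ∑ xs (λ x → ∑ xs (mixed x)) ≡ 2 * (first * first)
    ∑∑-mixed = begin
      ∑ xs (λ x → ∑ xs (mixed x))
        ≡⟨ ∑-cong xs (λ x → trans (∑-cong xs λ y → rearrange (w x) (w y) (d x) (d y))
                                  (∑-*ˡ xs (2 * (w x * d x)) _)) ⟩
      ∑ xs (λ x → 2 * (w x * d x) * first)  ≡⟨ ∑-*ʳ xs first _ ⟩
      ∑ xs (λ x → 2 * (w x * d x)) * first  ≡⟨ cong (_* first) (∑-*ˡ xs 2 _) ⟩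
      2 * first * first                     ≡⟨ *-assoc 2 first first ⟩
      2 * (first * first)                   ∎
      where
      rearrange : ∀ a b x y → a * b * (2 * (x * y)) ≡ 2 * (a * x) * (b * y)
      rearrange = solve-∀

    ∑∑-square : ∑ xs (λ x → ∑ xs (square x)) ≡ 2 * (mass * second)
    ∑∑-square = begin
      ∑ xs (λ x → ∑ xs (square x))
        ≡⟨ ∑-cong xs (λ x → trans (∑-cong xs λ y → rearrange (w x) (w y) (d x) (d y))
             (trans (∑-+ xs _ _) (cong₂ _+_ (∑-*ˡ xs (w x * (d x * d x)) w) (∑-*ˡ xs (w x) _)))) ⟩
      ∑ xs (λ x → w x * (d x * d x) * mass + w x * second)
        ≡⟨ trans (∑-+ xs _ _) (cong₂ _+_ (∑-*ʳ xs mass _) (∑-*ʳ xs second _)) ⟩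
      second * mass + mass * second  ≡⟨ double second mass ⟩
      2 * (mass * second)            ∎
      where
      rearrange : ∀ a b x y → a * b * (x * x + y * y) ≡ a * (x * x) * b + a * (b * (y * y))
      rearrange = solve-∀
      double : ∀ a b → a * b + b * a ≡ 2 * (b * a)
      double = solve-∀

    mixed≤square : ∀ x y → mixed x y ≤ square x y
    mixed≤square x y = *-monoʳ-≤ (w x * w y) (cauchy-term (d x) (d y))

  cauchy-schwarz : first * first ≤ mass * second
  cauchy-schwarz = *-cancelˡ-≤ 2 (subst₂ _≤_ ∑∑-mixed ∑∑-square
    (∑-mono xs λ x → ∑-mono xs λ y → mixed≤square x y))

  -- Equality of the double sums forces equality of the row of x and then of its entry at y; unit
  -- weights leave the equality case of `cauchy-term`.
  cauchy-schwarz-tight : mass * second ≤ first * first →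
    ∀ {x y} → x ∈ xs → y ∈ xs → w x ≡ 1 → w y ≡ 1 → d x ≡ d y
  cauchy-schwarz-tight tight {x} {y} x∈xs y∈xs wx≡1 wy≡1 = cauchy-term-tight (d x) (d y) (begin
    2 * (d x * d y)        ≡⟨ sym (unit (2 * (d x * d y))) ⟩
    mixed x y              ≡⟨ ∑-tight (mixed≤square x) (≤-reflexive (sym inner)) y∈xs ⟩
    square x y             ≡⟨ unit (d x * d x + d y * d y) ⟩
    d x * d x + d y * d y  ∎)
    where
    unit : ∀ c → w x * w y * c ≡ c
    unit c rewrite wx≡1 | wy≡1 = +-identityʳ c
    inner : ∑ xs (mixed x) ≡ ∑ xs (square x)
    inner = ∑-tight (λ x → ∑-mono xs (mixed≤square x))
      (subst₂ _≤_ (sym ∑∑-square) (sym ∑∑-mixed) (*-monoʳ-≤ 2 tight)) x∈xs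

-- Indicator functions

𝟙 : Bool → ℕ
𝟙 b = if b then 1 else 0

𝟙-cong : ∀ b {x y} → (b ≡ true → x ≡ y) → 𝟙 b * x ≡ 𝟙 b * y
𝟙-cong true  x≡y = cong (1 *_) (x≡y refl)
𝟙-cong false x≡y = refl

𝟙-mono : ∀ b {x y} → (b ≡ true → x ≤ y) → 𝟙 b * x ≤ 𝟙 b * y
𝟙-mono true  x≤y = *-monoʳ-≤ 1 (x≤y refl)
𝟙-mono false x≤y = z≤n

not-true : ∀ {b} → not b ≡ true → b ≡ false
not-true {false} _ = refl

𝟙+𝟙not : ∀ b → 𝟙 b + 𝟙 (not b) ≡ 1
𝟙+𝟙not true  = refl
𝟙+𝟙not false = refl

𝟙*x≤x : ∀ b x → 𝟙 b * x ≤ x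
𝟙*x≤x true  x = ≤-reflexive (+-identityʳ x)
𝟙*x≤x false x = z≤n

-- Sums over vertices and over sets of vertices

∑ᵥ : (Fin n → ℕ) → ℕ
∑ᵥ {n} = ∑ (allFin n)

∑ₛ : (Subset n → ℕ) → ℕ
∑ₛ {n} = ∑ (allSubsets n)

infixl 7 _⊕_ _⊖_
-- Both are total updates, without effect when x is already present or already absent, so the sums
-- below guard them with `out` and `inn`.
_⊕_ _⊖_ : Subset n → Fin n → Subset n
S ⊕ x = S [ x ]≔ true
S ⊖ x = S [ x ]≔ false

inn out : Subset n → Fin n → ℕ
inn S x = 𝟙 (lookup S x)
out S x = 𝟙 (not (lookup S x))

hasSize : ℕ → Subset n → Bool
hasSize k S = ∣ S ∣ ≡ᵇ k

∑ᵥ-suc : ∀ (f : Fin (suc n) → ℕ) → ∑ᵥ f ≡ f zero + ∑ᵥ (f ∘ suc)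
∑ᵥ-suc f = cong (λ ys → f zero + sum ys) (trans (map-tabulate suc f) (sym (map-tabulate id (f ∘ suc))))

∑ₛ-suc : ∀ (f : Subset (suc n) → ℕ) → ∑ₛ f ≡ ∑ₛ (f ∘ (false ∷_)) + ∑ₛ (f ∘ (true ∷_))
∑ₛ-suc {n} f = trans (∑-++ (map (false ∷_) (allSubsets n)) _ f)
  (cong₂ _+_ (cong sum (sym (map-∘ (allSubsets n)))) (cong sum (sym (map-∘ (allSubsets n)))))

∈-allSubsets : ∀ (S : Subset n) → S ∈ allSubsets n
∈-allSubsets []          = here refl
∈-allSubsets (false ∷ S) = ∈-++⁺ˡ (∈-map⁺ (false ∷_) (∈-allSubsets S))
∈-allSubsets (true ∷ S)  = ∈-++⁺ʳ _ (∈-map⁺ (true ∷_) (∈-allSubsets S))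

-- Adding `x` is a bijection from the sets avoiding `x` onto the sets containing it, with removal of
-- `x` as its inverse.
exchange-at : ∀ (x : Fin n) (f : Subset n → Subset n → ℕ) →
  ∑ₛ (λ S → out S x * f S (S ⊕ x)) ≡ ∑ₛ (λ T → inn T x * f (T ⊖ x) T)
exchange-at {suc n} zero f = begin
  ∑ₛ (λ S → out S zero * f S (S ⊕ zero))  ≡⟨ ∑ₛ-suc {n} (λ S → out S zero * f S (S ⊕ zero)) ⟩
  ∑ₛ (λ S → 1 * g S) + ∑ₛ {n} (λ _ → 0)   ≡⟨ +-comm _ (∑ₛ {n} λ _ → 0) ⟩
  ∑ₛ {n} (λ _ → 0) + ∑ₛ (λ S → 1 * g S)   ≡⟨ ∑ₛ-suc {n} (λ T → inn T zero * f (T ⊖ zero) T) ⟨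
  ∑ₛ (λ T → inn T zero * f (T ⊖ zero) T)  ∎
  where
  g : Subset n → ℕ
  g S = f (false ∷ S) (true ∷ S)
exchange-at {suc n} (suc x) f = trans (∑ₛ-suc {n} λ S → out S (suc x) * f S (S ⊕ suc x)) (trans
  (cong₂ _+_ (exchange-at x λ S T → f (false ∷ S) (false ∷ T)) (exchange-at x λ S T → f (true ∷ S) (true ∷ T)))
  (sym (∑ₛ-suc {n} λ T → inn T (suc x) * f (T ⊖ suc x) T)))

-- The basic double count: a set together with a one-vertex enlargement is counted from the smaller
-- set on the left and from the larger one on the right.
exchange : ∀ (f : Subset n → Fin n → Subset n → ℕ) →
  ∑ₛ (λ S → ∑ᵥ λ x → out S x * f S x (S ⊕ x)) ≡ ∑ₛ (λ T → ∑ᵥ λ x → inn T x * f (T ⊖ x) x T)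
exchange {n} f = begin
  ∑ₛ (λ S → ∑ᵥ λ x → out S x * f S x (S ⊕ x))  ≡⟨ ∑-swap (allSubsets n) (allFin n) _ ⟩
  ∑ᵥ (λ x → ∑ₛ λ S → out S x * f S x (S ⊕ x))  ≡⟨ ∑-cong (allFin n) (λ x → exchange-at x λ S T → f S x T) ⟩
  ∑ᵥ (λ x → ∑ₛ λ T → inn T x * f (T ⊖ x) x T)  ≡⟨ ∑-swap (allFin n) (allSubsets n) _ ⟩
  ∑ₛ (λ T → ∑ᵥ λ x → inn T x * f (T ⊖ x) x T)  ∎

∑-inn : ∀ (S : Subset n) → ∑ᵥ (inn S) ≡ ∣ S ∣
∑-inn []          = refl
∑-inn (false ∷ S) = trans (∑ᵥ-suc (inn (false ∷ S))) (∑-inn S)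
∑-inn (true ∷ S)  = trans (∑ᵥ-suc (inn (true ∷ S))) (cong suc (∑-inn S))

∑-out : ∀ (S : Subset n) → ∣ S ∣ + ∑ᵥ (out S) ≡ n
∑-out []          = refl
∑-out (false ∷ S) = trans (cong (∣ S ∣ +_) (∑ᵥ-suc (out (false ∷ S))))
                          (trans (+-suc ∣ S ∣ _) (cong suc (∑-out S)))
∑-out (true ∷ S)  = cong suc (trans (cong (∣ S ∣ +_) (∑ᵥ-suc (out (true ∷ S)))) (∑-out S))

∣⊕∣ : ∀ (S : Subset n) x → lookup S x ≡ false → ∣ S ⊕ x ∣ ≡ suc ∣ S ∣
∣⊕∣ (false ∷ S) zero    _   = refl
∣⊕∣ (false ∷ S) (suc x) x∉S = ∣⊕∣ S x x∉S
∣⊕∣ (true ∷ S)  (suc x) x∉S = cong suc (∣⊕∣ S x x∉S)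

∣⊖∣ : ∀ (S : Subset n) x → lookup S x ≡ true → suc ∣ S ⊖ x ∣ ≡ ∣ S ∣
∣⊖∣ (true ∷ S)  zero    _   = refl
∣⊖∣ (false ∷ S) (suc x) x∈S = ∣⊖∣ S x x∈S
∣⊖∣ (true ∷ S)  (suc x) x∈S = cong suc (∣⊖∣ S x x∈S)

-- Splitting on the first vertex gives Pascal's rule.
∑-hasSize : ∀ n k → ∑ₛ {n} (λ S → 𝟙 (hasSize k S)) ≡ n C k
∑-hasSize zero    zero    = refl
∑-hasSize zero    (suc k) = refl
∑-hasSize (suc n) zero    = trans (∑ₛ-suc {n} λ S → 𝟙 (hasSize 0 S))
  (cong₂ _+_ (∑-hasSize n 0) (∑-zero (allSubsets n) λ _ → refl))
∑-hasSize (suc n) (suc k) = begin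
  ∑ₛ {suc n} (λ S → 𝟙 (hasSize (suc k) S))  ≡⟨ ∑ₛ-suc {n} (λ S → 𝟙 (hasSize (suc k) S)) ⟩
  ∑ₛ {n} (λ S → 𝟙 (hasSize (suc k) S)) + ∑ₛ {n} (λ S → 𝟙 (hasSize k S))
                                            ≡⟨ cong₂ _+_ (∑-hasSize n (suc k)) (∑-hasSize n k) ⟩
  n C suc k + n C k                         ≡⟨ +-comm (n C suc k) _ ⟩
  n C k + n C suc k                         ≡⟨ nCk+nC[k+1]≡[n+1]C[k+1] n k ⟩
  suc n C suc k                             ∎

hasSize⇒ : ∀ k (S : Subset n) → hasSize k S ≡ true → ∣ S ∣ ≡ k
hasSize⇒ k S eq = ≡ᵇ⇒≡ ∣ S ∣ k (subst T (sym eq) _)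

⇒hasSize : ∀ k (S : Subset n) → ∣ S ∣ ≡ k → hasSize k S ≡ true
⇒hasSize k S refl = n≡ᵇn k
  where
  n≡ᵇn : ∀ k → (k ≡ᵇ k) ≡ true
  n≡ᵇn zero    = refl
  n≡ᵇn (suc k) = n≡ᵇn k

∃-size : ∀ {k n} → k ≤ n → ∃ λ (S : Subset n) → ∣ S ∣ ≡ k
∃-size {n = zero}  z≤n       = [] , refl
∃-size {n = suc n} z≤n with ∃-size {0} {n} z≤n
... | S , eq = false ∷ S , eq
∃-size {n = suc n} (s≤s k≤n) with ∃-size k≤n
... | S , eq = true ∷ S , cong suc eq

-- Both sides count the pairs of a k-set inside a (k + 1)-set; `suc m` is n - k.
binomial-step : ∀ {n} k m → suc k + m ≡ n → (n C suc k) * suc k ≡ (n C k) * suc m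
binomial-step {n} k m eq = begin
  (n C suc k) * suc k  ≡⟨ cong (_* suc k) (∑-hasSize n (suc k)) ⟨
  ∑ₛ {n} (λ T → 𝟙 (hasSize (suc k) T)) * suc k  ≡⟨ ∑-*ʳ (allSubsets n) (suc k) _ ⟨
  ∑ₛ {n} (λ T → 𝟙 (hasSize (suc k) T) * suc k)
    ≡⟨ ∑-cong (allSubsets n) (λ T → trans (𝟙-cong (hasSize (suc k) T) λ h →
         sym (trans (∑-inn T) (hasSize⇒ (suc k) T h))) (sym (∑-*ˡ (allFin n) (𝟙 (hasSize (suc k) T)) (inn T)))) ⟩
  ∑ₛ {n} (λ T → ∑ᵥ λ x → 𝟙 (hasSize (suc k) T) * inn T x)
    ≡⟨ ∑-cong (allSubsets n) (λ T → ∑-cong (allFin n) λ x → *-comm (𝟙 (hasSize (suc k) T)) (inn T x)) ⟩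
  ∑ₛ {n} (λ T → ∑ᵥ λ x → inn T x * 𝟙 (hasSize (suc k) T))
    ≡⟨ exchange {n} (λ _ _ T → 𝟙 (hasSize (suc k) T)) ⟨
  ∑ₛ {n} (λ S → ∑ᵥ λ x → out S x * 𝟙 (hasSize (suc k) (S ⊕ x)))
    ≡⟨ ∑-cong (allSubsets n) (λ S → trans (∑-cong (allFin n) λ x → 𝟙-cong (not (lookup S x)) λ x∉S →
         cong (λ s → 𝟙 (s ≡ᵇ suc k)) (∣⊕∣ S x (not-true x∉S))) (∑-*ʳ (allFin n) (𝟙 (hasSize k S)) (out S))) ⟩
  ∑ₛ {n} (λ S → ∑ᵥ (out S) * 𝟙 (hasSize k S))
    ≡⟨ ∑-cong (allSubsets n) (λ S → trans (*-comm (∑ᵥ (out S)) _) (𝟙-cong (hasSize k S) λ h →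
         outside S (hasSize⇒ k S h))) ⟩
  ∑ₛ {n} (λ S → 𝟙 (hasSize k S) * suc m)  ≡⟨ ∑-*ʳ (allSubsets n) (suc m) _ ⟩
  ∑ₛ {n} (λ S → 𝟙 (hasSize k S)) * suc m  ≡⟨ cong (_* suc m) (∑-hasSize n k) ⟩
  (n C k) * suc m  ∎
  where
  outside : ∀ (S : Subset n) → ∣ S ∣ ≡ k → ∑ᵥ (out S) ≡ suc m
  outside S refl = +-cancelˡ-≡ ∣ S ∣ _ _ (trans (∑-out S) (trans (sym eq) (sym (+-suc k m))))

∑ᵥ-remove : ∀ (S : Subset n) x (g : Fin n → ℕ) → lookup S x ≡ false →
  ∑ᵥ (λ v → out S v * g v) ≡ g x + ∑ᵥ (λ v → out (S ⊕ x) v * g v)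
∑ᵥ-remove (false ∷ S) zero g _ = begin
  ∑ᵥ (λ v → out (false ∷ S) v * g v)                ≡⟨ ∑ᵥ-suc (λ v → out (false ∷ S) v * g v) ⟩
  g zero + 0 + ∑ᵥ (λ v → out S v * g (suc v))       ≡⟨ cong (_+ ∑ᵥ (λ v → out S v * g (suc v))) (+-identityʳ (g zero)) ⟩
  g zero + ∑ᵥ (λ v → out S v * g (suc v))           ≡⟨ cong (g zero +_) (∑ᵥ-suc (λ v → out (true ∷ S) v * g v)) ⟨
  g zero + ∑ᵥ (λ v → out (true ∷ S) v * g v)        ∎
∑ᵥ-remove (b ∷ S) (suc x) g x∉S = begin
  ∑ᵥ (λ v → out (b ∷ S) v * g v)   ≡⟨ ∑ᵥ-suc (λ v → out (b ∷ S) v * g v) ⟩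
  h + ∑ᵥ (λ v → out S v * g (suc v))                ≡⟨ cong (h +_) (∑ᵥ-remove S x (g ∘ suc) x∉S) ⟩
  h + (g (suc x) + rest)                            ≡⟨ swap h (g (suc x)) rest ⟩
  g (suc x) + (h + rest)                            ≡⟨ cong (g (suc x) +_) (∑ᵥ-suc (λ v → out (b ∷ S ⊕ x) v * g v)) ⟨
  g (suc x) + ∑ᵥ (λ v → out (b ∷ S ⊕ x) v * g v)  ∎
  where
  h = 𝟙 (not b) * g zero
  rest = ∑ᵥ (λ v → out (S ⊕ x) v * g (suc v))
  swap : ∀ a b c → a + (b + c) ≡ b + (a + c)
  swap = solve-∀

∑ᵥ-unique : ∀ (u : Fin n) {f : Fin n → ℕ} → f u ≡ 1 → (∀ v → v ≢ u → f v ≡ 0) → ∑ᵥ f ≡ 1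
∑ᵥ-unique zero {f} fu≡1 f≡0 = trans (∑ᵥ-suc f) (cong₂ _+_ fu≡1 (∑-zero (allFin _) λ v → f≡0 (suc v) λ ()))
∑ᵥ-unique (suc u) {f} fu≡1 f≡0 = trans (∑ᵥ-suc f)
  (cong₂ _+_ (f≡0 zero λ ()) (∑ᵥ-unique u fu≡1 λ v v≢u → f≡0 (suc v) λ { refl → v≢u refl }))

∑ᵥ-pair : ∀ (f : Fin n → ℕ) y z → y ≢ z → f y + f z ≤ ∑ᵥ f
∑ᵥ-pair f zero    zero    y≢z = contradiction refl y≢z
∑ᵥ-pair f zero    (suc z) y≢z = ≤-trans (+-monoʳ-≤ (f zero) (∑-∈-≤ (f ∘ suc) (∈-allFin z)))
  (≤-reflexive (sym (∑ᵥ-suc f)))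
∑ᵥ-pair f (suc y) zero    y≢z = ≤-trans (≤-reflexive (+-comm (f (suc y)) _))
  (∑ᵥ-pair f zero (suc y) (y≢z ∘ sym))
∑ᵥ-pair f (suc y) (suc z) y≢z = ≤-trans (∑ᵥ-pair (f ∘ suc) y z (y≢z ∘ cong suc))
  (≤-trans (m≤n+m _ (f zero)) (≤-reflexive (sym (∑ᵥ-suc f))))

-- Graphs without small components

-- Handshake argument: the first row and first column agree and the diagonal vanishes, so stripping
-- them off removes an even amount.
symmetric-sum-even : ∀ (N : Fin n → Fin n → ℕ) → (∀ x y → N x y ≡ N y x) → (∀ x → N x x ≡ 0) →
  ∃ λ m → ∑ᵥ (λ x → ∑ᵥ (N x)) ≡ 2 * m
symmetric-sum-even {zero}  N N-sym N-irr = 0 , refl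
symmetric-sum-even {suc n} N N-sym N-irr with symmetric-sum-even (λ x y → N (suc x) (suc y))
  (λ x y → N-sym (suc x) (suc y)) (λ x → N-irr (suc x))
... | m , eq = row + m , (begin
  ∑ᵥ (λ x → ∑ᵥ (N x))                        ≡⟨ ∑ᵥ-suc (λ x → ∑ᵥ (N x)) ⟩
  ∑ᵥ (N zero) + ∑ᵥ (λ x → ∑ᵥ (N (suc x)))    ≡⟨ cong₂ _+_ (trans (∑ᵥ-suc (N zero)) (cong (_+ row) (N-irr zero))) lower ⟩
  row + (row + 2 * m)                        ≡⟨ double row m ⟩
  2 * (row + m)                              ∎)
  where
  row = ∑ᵥ (λ y → N zero (suc y))
  lower : ∑ᵥ (λ x → ∑ᵥ (N (suc x))) ≡ row + 2 * m
  lower = begin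
    ∑ᵥ (λ x → ∑ᵥ (N (suc x)))
      ≡⟨ ∑-cong (allFin n) (λ x → trans (∑ᵥ-suc (N (suc x))) (cong (_+ ∑ᵥ (N (suc x) ∘ suc)) (N-sym (suc x) zero))) ⟩
    ∑ᵥ (λ x → N zero (suc x) + ∑ᵥ (λ y → N (suc x) (suc y)))  ≡⟨ ∑-+ (allFin n) _ _ ⟩
    row + ∑ᵥ (λ x → ∑ᵥ (λ y → N (suc x) (suc y)))              ≡⟨ cong (row +_) eq ⟩
    row + 2 * m                                                ∎
  double : ∀ a m → a + (a + 2 * m) ≡ 2 * (a + m)
  double = solve-∀

-- `N` is read as an adjacency matrix and `V` as the vertex set. The degree sum is twice the number
-- of edges, so `four-thirds` amounts to at least 2|V|/3 edges.
module Discharging (N : Fin n → Fin n → ℕ) (N-sym : ∀ x y → N x y ≡ N y x) (V : Fin n → Bool) where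

  deg : Fin n → ℕ
  deg x = ∑ᵥ (N x)

  leaf : Fin n → ℕ
  leaf x = 𝟙 (deg x ≡ᵇ 1)

  module _ (outside : ∀ x → V x ≡ false → deg x ≡ 0)
           (no-isolated-vertex : ∀ x → V x ≡ true → deg x ≢ 0)
           (no-isolated-edge : ∀ x y → deg x ≡ 1 → deg y ≡ 1 → N x y ≡ 0) where

    private
      toLeaves fromLeaf : Fin n → ℕ
      toLeaves x = ∑ᵥ (λ y → N x y * leaf y)
      fromLeaf x = ∑ᵥ (λ y → N x y * leaf x)

      toLeaves≤deg : ∀ x → toLeaves x ≤ deg x
      toLeaves≤deg x = ∑-mono (allFin n) λ y → ≤-trans (≤-reflexive (*-comm (N x y) _)) (𝟙*x≤x (deg y ≡ᵇ 1) (N x y))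

      leaf-isolated : ∀ x → deg x ≡ 1 → toLeaves x ≡ 0
      leaf-isolated x dx≡1 = ∑-zero (allFin n) vanish
        where
        vanish : ∀ y → N x y * leaf y ≡ 0
        vanish y with deg y ≡ᵇ 1 in eq
        ... | false = *-zeroʳ (N x y)
        ... | true  = trans (*-identityʳ _) (no-isolated-edge x y dx≡1 (≡ᵇ⇒≡ (deg y) 1 (subst T (sym eq) _)))

      local : ∀ x → 4 * 𝟙 (V x) + toLeaves x ≤ 3 * deg x + fromLeaf x
      local x with V x in Vx
      ... | false = ≤-trans (≤-trans (toLeaves≤deg x) (≤-reflexive (outside x Vx))) z≤n
      ... | true with deg x in dx
      ...   | 0 = contradiction dx (no-isolated-vertex x Vx)
      -- A leaf has no leaf as neighbour, so it lends nothing, and it borrows exactly one unit: 4 =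
      -- 3 + 1.
      ...   | 1 = ≤-reflexive (trans (cong (4 +_) (leaf-isolated x dx))
                    (cong (3 +_) (sym (trans (∑-cong (allFin n) λ y → *-identityʳ (N x y)) dx))))
      -- Even lending along every edge is affordable, as 4 + (2 + d) ≤ 3 (2 + d).
      ...   | suc (suc d) = ≤-trans
              (≤-trans (+-monoʳ-≤ 4 (≤-trans (toLeaves≤deg x) (≤-reflexive dx)))
                       (≤-trans (m≤m+n (6 + d) (2 * d)) (≤-reflexive (triple d))))
              (m≤m+n _ _)
        where
        triple : ∀ d → 6 + d + 2 * d ≡ 3 * (2 + d)
        triple = solve-∀

      -- Every unit borrowed is lent by the other end of the same edge, because `N` is symmetric.
      balance : ∑ᵥ toLeaves ≡ ∑ᵥ fromLeaf
      balance = trans (∑-swap (allFin n) (allFin n) _)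
        (∑-cong (allFin n) λ y → ∑-cong (allFin n) λ x → cong (_* leaf y) (N-sym x y))

    -- A vertex of degree one borrows one unit from its neighbour, which has degree d ≥ 2 and
    -- hence a surplus of 3 d − 4 ≥ d.
    four-thirds : 4 * ∑ᵥ (𝟙 ∘ V) ≤ 3 * ∑ᵥ deg
    four-thirds = +-cancelʳ-≤ (∑ᵥ toLeaves) _ _ (subst₂ _≤_
      (trans (∑-+ (allFin n) _ _) (cong (_+ ∑ᵥ toLeaves) (∑-*ˡ (allFin n) 4 _)))
      (trans (∑-+ (allFin n) _ _) (cong₂ _+_ (∑-*ˡ (allFin n) 3 _) (sym balance)))
      (∑-mono (allFin n) local))

-- Inserting and deleting vertices

⊕⊖ : ∀ (S : Subset n) x → lookup S x ≡ false → S ⊕ x ⊖ x ≡ S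
⊕⊖ S x x∉S = trans ([]≔-idempotent S x) (trans (cong (S [ x ]≔_) (sym x∉S)) ([]≔-lookup S x))

⊖⊕ : ∀ (S : Subset n) x → lookup S x ≡ true → S ⊖ x ⊕ x ≡ S
⊖⊕ S x x∈S = trans ([]≔-idempotent S x) (trans (cong (S [ x ]≔_) (sym x∈S)) ([]≔-lookup S x))

∈-⊕ : ∀ (S : Subset n) x y → lookup S y ≡ true → lookup (S ⊕ x) y ≡ true
∈-⊕ S x y y∈S with y ≟ᵥ x
... | yes refl = lookup∘update x S true
... | no y≢x   = trans (lookup∘update′ y≢x S true) y∈S

∈-⊖ : ∀ (S : Subset n) x y → lookup (S ⊖ x) y ≡ true → y ≢ x × lookup S y ≡ true
∈-⊖ S x y y∈S⊖x with y ≟ᵥ x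
... | yes refl = contradiction (trans (sym y∈S⊖x) (lookup∘update x S false)) λ ()
... | no y≢x   = y≢x , trans (sym (lookup∘update′ y≢x S false)) y∈S⊖x

∈-⊖⁺ : ∀ (S : Subset n) {x y} → y ≢ x → lookup S y ≡ true → lookup (S ⊖ x) y ≡ true
∈-⊖⁺ S y≢x y∈S = trans (lookup∘update′ y≢x S false) y∈S

∉-⊖⁺ : ∀ (S : Subset n) x y → lookup S y ≡ false → lookup (S ⊖ x) y ≡ false
∉-⊖⁺ S x y y∉S with lookup (S ⊖ x) y in eq
... | false = refl
... | true  = trans (sym (proj₂ (∈-⊖ S x y eq))) y∉S

∈∉⇒≢ : ∀ (S : Subset n) {x y} → lookup S x ≡ true → lookup S y ≡ false → x ≢ y
∈∉⇒≢ S x∈S y∉S refl with trans (sym x∈S) y∉S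
... | ()

∪⁅⁆≡⊕ : ∀ (S : Subset n) u → S ∪ ⁅ u ⁆ ≡ S ⊕ u
∪⁅⁆≡⊕ (b ∷ S) zero    = cong₂ _∷_ (Bool.∨-zeroʳ b) (∪-identityʳ S)
∪⁅⁆≡⊕ (b ∷ S) (suc u) = cong₂ _∷_ (Bool.∨-identityʳ b) (∪⁅⁆≡⊕ S u)

⊖-⊆ : ∀ (S : Subset n) x → S ⊖ x ⊆ S
⊖-⊆ S x {y} y∈S⊖x = lookup⇒[]= y S (proj₂ (∈-⊖ S x y ([]=⇒lookup y∈S⊖x)))

⊆-full : ∀ {B A : Subset n} → B ⊆ A → ∣ A ∣ ≤ ∣ B ∣ → B ≡ A
⊆-full {B = []} {[]} _ _ = refl
⊆-full {B = false ∷ B} {false ∷ A} B⊆A le = cong (false ∷_) (⊆-full (drop-∷-⊆ B⊆A) le)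
⊆-full {B = true ∷ B} {true ∷ A} B⊆A (s≤s le) = cong (true ∷_) (⊆-full (drop-∷-⊆ B⊆A) le)
⊆-full {B = true ∷ B} {false ∷ A} B⊆A le with B⊆A here
... | ()
⊆-full {B = false ∷ B} {true ∷ A} B⊆A le with ⊆-full (drop-∷-⊆ B⊆A) (≤-trans (n≤1+n _) le)
... | refl = contradiction le 1+n≰n

-- This turns the quantifier over (r - 1)-subsets in `IsFriend` into one over the deleted vertex.
⊆-corank-one : ∀ {B A : Subset n} → B ⊆ A → suc ∣ B ∣ ≡ ∣ A ∣ → ∃ λ x → lookup A x ≡ true × B ≡ A ⊖ x
⊆-corank-one {B = []} {[]} _ ()
⊆-corank-one {B = false ∷ B} {false ∷ A} B⊆A eq with ⊆-corank-one (drop-∷-⊆ B⊆A) eq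
... | x , x∈A , refl = suc x , x∈A , refl
⊆-corank-one {B = true ∷ B} {true ∷ A} B⊆A eq with ⊆-corank-one (drop-∷-⊆ B⊆A) (suc-injective eq)
... | x , x∈A , refl = suc x , x∈A , refl
⊆-corank-one {B = true ∷ B} {false ∷ A} B⊆A eq with B⊆A here
... | ()
⊆-corank-one {B = false ∷ B} {true ∷ A} B⊆A eq =
  zero , refl , cong (false ∷_) (⊆-full (drop-∷-⊆ B⊆A) (≤-reflexive (sym (suc-injective eq))))

-- Degrees as sums over vertices

infix 4 _⊆ᵇ_
_⊆ᵇ_ : Subset n → Subset n → Bool
[]      ⊆ᵇ []      = true
(x ∷ S) ⊆ᵇ (y ∷ T) = (not x ∨ y) ∧ (S ⊆ᵇ T)

-- The predicate counted by `degree` is anonymous; `refl` lets unification recover it, so that it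
-- can be analysed pointwise.
degreeTest : ∀ {r n} (H : Hypergraph r n) (S : Subset n) →
             Σ (Subset n → Bool) (λ P → degree H S ≡ countSubsets P)
degreeTest H S = _ , refl

-- `subset` is the containment test local to `degree`, which has no accessible name: it is solved
-- for by unification in `capture`, where the `with` clauses make its arguments distinct variables.
mutual
  subset : ∀ {r n} → Hypergraph r n → Subset n → ∀ {m} → Subset m → Subset m → Bool
  subset = _

  capture : ∀ {r n} (H : Hypergraph r (suc n)) S T → proj₁ (degreeTest H (true ∷ S)) (true ∷ T) ≡ true →
            ∃ λ N → Σ (Hypergraph r N) λ H′ → ∃ λ S′ → subset H′ S′ S T ≡ true
  capture {n = n} H S T p with true ← isEdge H (true ∷ T) with suc n | H | true ∷ S
  ... | N | H′ | S′ = N , H′ , S′ , p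

subset≡⊆ᵇ : ∀ {r n} (H : Hypergraph r n) S′ {m} (S T : Subset m) → subset H S′ S T ≡ (S ⊆ᵇ T)
subset≡⊆ᵇ H S′ []          []          = refl
subset≡⊆ᵇ H S′ (false ∷ S) (y ∷ T)     = subset≡⊆ᵇ H S′ S T
subset≡⊆ᵇ H S′ (true ∷ S)  (false ∷ T) = refl
subset≡⊆ᵇ H S′ (true ∷ S)  (true ∷ T)  = subset≡⊆ᵇ H S′ S T

degree≡ : ∀ {r n} (H : Hypergraph r n) S → degree H S ≡ ∑ₛ (λ T → 𝟙 (isEdge H T) * 𝟙 (S ⊆ᵇ T))
degree≡ {n = n} H S = ∑-cong (allSubsets n) pointwise
  where
  pointwise : ∀ T → 𝟙 (proj₁ (degreeTest H S) T) ≡ 𝟙 (isEdge H T) * 𝟙 (S ⊆ᵇ T)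
  pointwise T with isEdge H T
  ... | false = refl
  ... | true  = trans (cong 𝟙 (subset≡⊆ᵇ H S S T)) (sym (+-identityʳ _))

⊆ᵇ⇒∣∣≤ : ∀ (S T : Subset n) → (S ⊆ᵇ T) ≡ true → ∣ S ∣ ≤ ∣ T ∣
⊆ᵇ⇒∣∣≤ []          []          _ = z≤n
⊆ᵇ⇒∣∣≤ (false ∷ S) (false ∷ T) p = ⊆ᵇ⇒∣∣≤ S T p
⊆ᵇ⇒∣∣≤ (false ∷ S) (true ∷ T)  p = ≤-trans (⊆ᵇ⇒∣∣≤ S T p) (n≤1+n _)
⊆ᵇ⇒∣∣≤ (true ∷ S)  (true ∷ T)  p = s≤s (⊆ᵇ⇒∣∣≤ S T p)

∑-⊇-sameSize : ∀ (S : Subset n) (φ : Subset n → ℕ) → (∀ T → ∣ T ∣ ≢ ∣ S ∣ → φ T ≡ 0) →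
  ∑ₛ (λ T → φ T * 𝟙 (S ⊆ᵇ T)) ≡ φ S
∑-⊇-sameSize [] φ _ = trans (+-identityʳ _) (*-identityʳ _)
∑-⊇-sameSize {suc n} (true ∷ S) φ φ≡0 = trans (∑ₛ-suc {n} λ T → φ T * 𝟙 ((true ∷ S) ⊆ᵇ T)) (cong₂ _+_
  (∑-zero (allSubsets n) λ T → *-zeroʳ (φ (false ∷ T)))
  (∑-⊇-sameSize S (φ ∘ (true ∷_)) λ T T≢S → φ≡0 (true ∷ T) (T≢S ∘ suc-injective)))
∑-⊇-sameSize {suc n} (false ∷ S) φ φ≡0 = trans (∑ₛ-suc {n} λ T → φ T * 𝟙 ((false ∷ S) ⊆ᵇ T)) (trans (cong₂ _+_
  (∑-⊇-sameSize S (φ ∘ (false ∷_)) λ T → φ≡0 (false ∷ T))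
  (∑-zero (allSubsets n) larger)) (+-identityʳ _))
  where
  larger : ∀ T → φ (true ∷ T) * 𝟙 (S ⊆ᵇ T) ≡ 0
  larger T with S ⊆ᵇ T in S⊆T
  ... | false = *-zeroʳ (φ (true ∷ T))
  ... | true  = trans (*-identityʳ _) (φ≡0 (true ∷ T) λ eq → 1+n≰n (≤-trans (≤-reflexive eq) (⊆ᵇ⇒∣∣≤ S T S⊆T)))

-- The supersets with one more element are the sets S + x with x outside S. If S omits the first
-- vertex, either T omits it too, or it is the added vertex and `∑-⊇-sameSize` settles the rest.
∑-⊇-nextSize : ∀ (S : Subset n) (φ : Subset n → ℕ) → (∀ T → ∣ T ∣ ≢ suc ∣ S ∣ → φ T ≡ 0) →
  ∑ₛ (λ T → φ T * 𝟙 (S ⊆ᵇ T)) ≡ ∑ᵥ (λ x → out S x * φ (S ⊕ x))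
∑-⊇-nextSize [] φ φ≡0 = cong (λ z → z * 1 + 0) (φ≡0 [] λ ())
∑-⊇-nextSize {suc n} (true ∷ S) φ φ≡0 = begin
  ∑ₛ (λ T → φ T * 𝟙 ((true ∷ S) ⊆ᵇ T))               ≡⟨ ∑ₛ-suc {n} (λ T → φ T * 𝟙 ((true ∷ S) ⊆ᵇ T)) ⟩
  ∑ₛ (λ T → φ (false ∷ T) * 0) + ∑ₛ (λ T → φ (true ∷ T) * 𝟙 (S ⊆ᵇ T))
    ≡⟨ cong₂ _+_ (∑-zero (allSubsets n) λ T → *-zeroʳ (φ (false ∷ T)))
         (∑-⊇-nextSize S (φ ∘ (true ∷_)) λ T T≢S → φ≡0 (true ∷ T) (T≢S ∘ suc-injective)) ⟩
  ∑ᵥ (λ x → out S x * φ (true ∷ S ⊕ x))              ≡⟨ ∑ᵥ-suc (λ x → out (true ∷ S) x * φ ((true ∷ S) ⊕ x)) ⟨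
  ∑ᵥ (λ x → out (true ∷ S) x * φ ((true ∷ S) ⊕ x))   ∎
∑-⊇-nextSize {suc n} (false ∷ S) φ φ≡0 = begin
  ∑ₛ (λ T → φ T * 𝟙 ((false ∷ S) ⊆ᵇ T))              ≡⟨ ∑ₛ-suc {n} (λ T → φ T * 𝟙 ((false ∷ S) ⊆ᵇ T)) ⟩
  ∑ₛ (λ T → φ (false ∷ T) * 𝟙 (S ⊆ᵇ T)) + ∑ₛ (λ T → φ (true ∷ T) * 𝟙 (S ⊆ᵇ T))
    ≡⟨ cong₂ _+_ (∑-⊇-nextSize S (φ ∘ (false ∷_)) λ T → φ≡0 (false ∷ T))
         (∑-⊇-sameSize S (φ ∘ (true ∷_)) λ T T≢S → φ≡0 (true ∷ T) (T≢S ∘ suc-injective)) ⟩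
  rest + φ (true ∷ S)                                ≡⟨ +-comm rest _ ⟩
  φ (true ∷ S) + rest                                ≡⟨ cong (_+ rest) (+-identityʳ _) ⟨
  1 * φ (true ∷ S) + rest                            ≡⟨ ∑ᵥ-suc (λ x → out (false ∷ S) x * φ ((false ∷ S) ⊕ x)) ⟨
  ∑ᵥ (λ x → out (false ∷ S) x * φ ((false ∷ S) ⊕ x)) ∎
  where
  rest = ∑ᵥ (λ x → out S x * φ (false ∷ S ⊕ x))

-- Friends and complete sets

does-true : ∀ {P : Set} (P? : Dec P) → does P? ≡ true → P
does-true (yes p) _ = p

-- The uniformity r is written `suc k`, so (r - 1)-sets have size k and complete sets have size k +
-- 2.
module FriendshipHypergraph {k n : ℕ} (H : Hypergraph (suc k) n) (friendship : IsFriendship H) where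

  edge : Subset n → ℕ
  edge T = 𝟙 (isEdge H T)

  -- `IsFriend` with B written as A - x and with updates in place of unions; the two notions agree
  -- on sets of size r.
  Friend : Subset n → Fin n → Set
  Friend A u = lookup A u ≡ false × (∀ x → lookup A x ≡ true → isEdge H (A ⊖ x ⊕ u) ≡ true)

  Friend⇒IsFriend : ∀ {A u} → ∣ A ∣ ≡ suc k → Friend A u → IsFriend H A u
  Friend⇒IsFriend {A} {u} ∣A∣≡r (u∉A , edges) = u∉ , allEdges
    where
    u∉ : _
    u∉ u∈A with trans (sym u∉A) ([]=⇒lookup u∈A)
    ... | ()
    allEdges : _
    allEdges B B⊆A ∣B∣≡k with ⊆-corank-one B⊆A (trans (cong suc ∣B∣≡k) (sym ∣A∣≡r))
    ... | x , x∈A , refl = trans (cong (isEdge H) (∪⁅⁆≡⊕ (A ⊖ x) u)) (edges x x∈A)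

  IsFriend⇒Friend : ∀ {A u} → ∣ A ∣ ≡ suc k → IsFriend H A u → Friend A u
  IsFriend⇒Friend {A} {u} ∣A∣≡r (u∉A , edges) = u∉ , λ x x∈A →
    trans (cong (isEdge H) (sym (∪⁅⁆≡⊕ (A ⊖ x) u)))
          (edges (A ⊖ x) (⊖-⊆ A x) (suc-injective (trans (∣⊖∣ A x x∈A) ∣A∣≡r)))
    where
    u∉ : lookup A u ≡ false
    u∉ with lookup A u in eq
    ... | false = refl
    ... | true  = contradiction (lookup⇒[]= u A eq) u∉A

  friend-exists : ∀ A → ∣ A ∣ ≡ suc k → ∃ (Friend A)
  friend-exists A ∣A∣≡r with friendship A ∣A∣≡r
  ... | u , isFriend , _ = u , IsFriend⇒Friend ∣A∣≡r isFriend

  friend-unique : ∀ {A u v} → ∣ A ∣ ≡ suc k → Friend A u → Friend A v → u ≡ v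
  friend-unique {A} ∣A∣≡r fu fv with friendship A ∣A∣≡r
  ... | w , _ , unique = trans (unique _ (Friend⇒IsFriend ∣A∣≡r fu)) (sym (unique _ (Friend⇒IsFriend ∣A∣≡r fv)))

  Complete : Subset n → Set
  Complete K = ∣ K ∣ ≡ suc (suc k) × (∀ x → lookup K x ≡ true → isEdge H (K ⊖ x) ≡ true)

  complete? : ∀ K → Dec (Complete K)
  complete? K = (∣ K ∣ ≟ suc (suc k)) ×-dec
    all? (λ x → (lookup K x Bool.≟ true) →-dec (isEdge H (K ⊖ x) Bool.≟ true))

  completeᵇ : Subset n → Bool
  completeᵇ K = does (complete? K)

  completeᵇ⇒ : ∀ K → completeᵇ K ≡ true → Complete K
  completeᵇ⇒ K = does-true (complete? K)

  ⇒completeᵇ : ∀ K → Complete K → completeᵇ K ≡ true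
  ⇒completeᵇ K = dec-true (complete? K)

  κ : Subset n → ℕ
  κ K = 𝟙 (completeᵇ K)

  -- Removing u from A + u leaves the hyperedge A; removing another x leaves A - x + u, a hyperedge
  -- because u is a friend.
  Friend⇒Complete : ∀ {A u} → ∣ A ∣ ≡ suc k → isEdge H A ≡ true → Friend A u → Complete (A ⊕ u)
  Friend⇒Complete {A} {u} ∣A∣≡r A∈H (u∉A , edges) = trans (∣⊕∣ A u u∉A) (cong suc ∣A∣≡r) , faces
    where
    faces : ∀ x → lookup (A ⊕ u) x ≡ true → isEdge H (A ⊕ u ⊖ x) ≡ true
    faces x x∈A⊕u with x ≟ᵥ u
    ... | yes refl = trans (cong (isEdge H) (⊕⊖ A x u∉A)) A∈H
    ... | no x≢u   = trans (cong (isEdge H) ([]≔-commutes A u x (x≢u ∘ sym)))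
                           (edges x (trans (sym (lookup∘update′ x≢u A true)) x∈A⊕u))

  Complete⇒Friend : ∀ {A u} → lookup A u ≡ false → Complete (A ⊕ u) → Friend A u
  Complete⇒Friend {A} {u} u∉A (_ , faces) = u∉A , λ x x∈A →
    trans (cong (isEdge H) (sym ([]≔-commutes A u x (∈∉⇒≢ A x∈A u∉A ∘ sym)))) (faces x (∈-⊕ A u x x∈A))

  Complete⇒edge : ∀ {A u} → lookup A u ≡ false → Complete (A ⊕ u) → isEdge H A ≡ true
  Complete⇒edge {A} {u} u∉A (_ , faces) =
    trans (cong (isEdge H) (sym (⊕⊖ A u u∉A))) (faces u (lookup∘update u A true))

  -- A + u is complete exactly when A is a hyperedge and u is its friend, and there is exactly one
  -- friend.
  completions : ∀ A → ∣ A ∣ ≡ suc k → ∑ᵥ (λ u → out A u * κ (A ⊕ u)) ≡ edge A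
  completions A ∣A∣≡r with isEdge H A in A∈H
  ... | false = ∑-zero (allFin n) none
    where
    none : ∀ u → out A u * κ (A ⊕ u) ≡ 0
    none u with lookup A u in u∉A | completeᵇ (A ⊕ u) in c
    ... | true  | _     = refl
    ... | false | false = refl
    ... | false | true with trans (sym A∈H) (Complete⇒edge u∉A (completeᵇ⇒ _ c))
    ...   | ()
  ... | true with friend-exists A ∣A∣≡r
  ...   | u , fu = ∑ᵥ-unique u one others
    where
    one : out A u * κ (A ⊕ u) ≡ 1
    one = cong₂ (λ a b → 𝟙 (not a) * 𝟙 b) (proj₁ fu) (⇒completeᵇ _ (Friend⇒Complete ∣A∣≡r A∈H fu))
    others : ∀ v → v ≢ u → out A v * κ (A ⊕ v) ≡ 0
    others v v≢u with lookup A v in v∉A | completeᵇ (A ⊕ v) in c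
    ... | true  | _     = refl
    ... | false | false = refl
    ... | false | true  = contradiction (friend-unique ∣A∣≡r (Complete⇒Friend v∉A (completeᵇ⇒ _ c)) fu) v≢u

  -- The graph on a complete set seen from an outside vertex

  module Outside {K : Subset n} (complete : Complete K) {v : Fin n} (v∉K : lookup K v ≡ false) where

    -- Pairs are ordered, so all totals below are twice the number of unordered pairs.
    pair : Fin n → Fin n → ℕ
    pair x y = inn K x * inn (K ⊖ x) y

    -- `missing` is the adjacency matrix of the graph to which discharging applies; `present` is
    -- that of its complement on `K`.
    present missing : Fin n → Fin n → ℕ
    present x y = pair x y * edge (K ⊖ x ⊖ y ⊕ v)
    missing x y = pair x y * 𝟙 (not (isEdge H (K ⊖ x ⊖ y ⊕ v)))

    pair-irr : ∀ x → pair x x ≡ 0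
    pair-irr x = trans (cong (λ b → inn K x * 𝟙 b) (lookup∘update x K false)) (*-zeroʳ (inn K x))

    pair-≢ : ∀ {x y} → x ≢ y → pair x y ≡ inn K x * inn K y
    pair-≢ {x} {y} x≢y = cong (λ b → inn K x * 𝟙 b) (lookup∘update′ (x≢y ∘ sym) K false)

    missing-irr : ∀ x → missing x x ≡ 0
    missing-irr x = cong (_* 𝟙 (not (isEdge H (K ⊖ x ⊖ x ⊕ v)))) (pair-irr x)

    missing-sym : ∀ x y → missing x y ≡ missing y x
    missing-sym x y with x ≟ᵥ y
    ... | yes refl = refl
    ... | no x≢y   = cong₂ (λ p A → p * 𝟙 (not (isEdge H (A ⊕ v))))
      (trans (pair-≢ x≢y) (trans (*-comm (inn K x) _) (sym (pair-≢ (x≢y ∘ sym))))) ([]≔-commutes K x y x≢y)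

    missing≡0⇒edge : ∀ {x y} → lookup K x ≡ true → lookup (K ⊖ x) y ≡ true → missing x y ≡ 0 →
                     isEdge H (K ⊖ x ⊖ y ⊕ v) ≡ true
    missing≡0⇒edge {x} {y} x∈K y∈K⊖x eq rewrite x∈K | y∈K⊖x with isEdge H (K ⊖ x ⊖ y ⊕ v)
    ... | true = refl
    missing≡0⇒edge x∈K y∈K⊖x () | false

    missing≢0 : ∀ {x y} → missing x y ≢ 0 →
                lookup K x ≡ true × lookup (K ⊖ x) y ≡ true
    missing≢0 {x} {y} ≢0 with lookup K x | lookup (K ⊖ x) y
    ... | false | _     = contradiction refl ≢0
    ... | true  | false = contradiction refl ≢0
    ... | true  | true  = refl , refl

    open Discharging missing missing-sym (lookup K) using (deg; four-thirds)

    deg-outside : ∀ x → lookup K x ≡ false → deg x ≡ 0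
    deg-outside x x∉K = ∑-zero (allFin n) λ y →
      cong (λ b → 𝟙 b * inn (K ⊖ x) y * 𝟙 (not (isEdge H (K ⊖ x ⊖ y ⊕ v)))) x∉K

    v≢ : ∀ {x} → lookup K x ≡ true → v ≢ x
    v≢ x∈K refl with trans (sym v∉K) x∈K
    ... | ()

    K⊖-friend : ∀ {x} → lookup K x ≡ true → Friend (K ⊖ x) x
    K⊖-friend {x} x∈K = Complete⇒Friend (lookup∘update x K false) (subst Complete (sym (⊖⊕ K x x∈K)) complete)

    ∣K⊖∣ : ∀ {x} → lookup K x ≡ true → ∣ K ⊖ x ∣ ≡ suc k
    ∣K⊖∣ {x} x∈K = suc-injective (trans (∣⊖∣ K x x∈K) (proj₁ complete))

    -- With no missing pair at x, v would be a friend of K - x, which already has the friend x;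
    -- uniqueness would give v = x, although v lies outside K.
    no-isolated-vertex : ∀ x → lookup K x ≡ true → deg x ≢ 0
    no-isolated-vertex x x∈K dx≡0 = v≢ x∈K (friend-unique (∣K⊖∣ x∈K)
      (∉-⊖⁺ K x v v∉K , λ y y∈K⊖x → missing≡0⇒edge x∈K y∈K⊖x
        (n≤0⇒n≡0 (≤-trans (∑-∈-≤ (missing x) (∈-allFin y)) (≤-reflexive dx≡0))))
      (K⊖-friend x∈K))

    leaf-rest : ∀ {x y z} → deg x ≡ 1 → missing x y ≢ 0 → y ≢ z → missing x z ≡ 0
    leaf-rest {x} {y} {z} dx≡1 ≢0 y≢z = n≤0⇒n≡0 (+-cancelˡ-≤ 1 _ _
      (≤-trans (+-monoˡ-≤ _ (n≢0⇒n>0 ≢0)) (≤-trans (∑ᵥ-pair (missing x) y z y≢z) (≤-reflexive dx≡1))))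

    -- If xy were an isolated edge, the non-edge K − x − y + v would have both x and y as friends.
    leaf-friend : ∀ {x y} → missing x y ≢ 0 → deg x ≡ 1 → Friend (K ⊖ x ⊖ y ⊕ v) y
    leaf-friend {x} {y} ≢0 dx≡1 =
      trans (lookup∘update′ (v≢ y∈K ∘ sym) (K ⊖ x ⊖ y) true) (lookup∘update y (K ⊖ x) false) , edges
      where
      x∈K = proj₁ (missing≢0 ≢0)
      y∈K⊖x = proj₂ (missing≢0 {x} ≢0)
      y≢x = proj₁ (∈-⊖ K x y y∈K⊖x)
      y∈K = proj₂ (∈-⊖ K x y y∈K⊖x)
      v∉ : lookup (K ⊖ x ⊖ y) v ≡ false
      v∉ = ∉-⊖⁺ (K ⊖ x) y v (∉-⊖⁺ K x v v∉K)
      edges : ∀ z → lookup (K ⊖ x ⊖ y ⊕ v) z ≡ true → isEdge H (K ⊖ x ⊖ y ⊕ v ⊖ z ⊕ y) ≡ true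
      edges z z∈B with z ≟ᵥ v
      -- Deleting v and adding y gives K - x, a face of the complete set.
      ... | yes refl = trans (cong (isEdge H) (trans (cong (_⊕ y) (⊕⊖ _ z v∉)) (⊖⊕ (K ⊖ x) y y∈K⊖x)))
                             (proj₂ complete x x∈K)
      -- The result is K - x - z + v, a hyperedge since y is the only missing partner of x.
      ... | no z≢v   = trans (cong (isEdge H) same) (missing≡0⇒edge x∈K z∈K⊖x (leaf-rest dx≡1 ≢0 (z≢y ∘ sym)))
        where
        z∈ = ∈-⊖ (K ⊖ x) y z (trans (sym (lookup∘update′ z≢v (K ⊖ x ⊖ y) true)) z∈B)
        z≢y = proj₁ z∈
        z∈K⊖x = proj₂ z∈
        same : K ⊖ x ⊖ y ⊕ v ⊖ z ⊕ y ≡ K ⊖ x ⊖ z ⊕ v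
        same = begin
          K ⊖ x ⊖ y ⊕ v ⊖ z ⊕ y  ≡⟨ cong (_⊕ y) ([]≔-commutes (K ⊖ x ⊖ y) v z (z≢v ∘ sym)) ⟩
          K ⊖ x ⊖ y ⊖ z ⊕ v ⊕ y  ≡⟨ []≔-commutes (K ⊖ x ⊖ y ⊖ z) v y (v≢ y∈K) ⟩
          K ⊖ x ⊖ y ⊖ z ⊕ y ⊕ v  ≡⟨ cong (_⊕ v) (cong (_⊕ y) ([]≔-commutes (K ⊖ x) y z (z≢y ∘ sym))) ⟩
          K ⊖ x ⊖ z ⊖ y ⊕ y ⊕ v  ≡⟨ cong (_⊕ v) (⊖⊕ (K ⊖ x ⊖ z) y (∈-⊖⁺ (K ⊖ x) (z≢y ∘ sym) y∈K⊖x)) ⟩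
          K ⊖ x ⊖ z ⊕ v          ∎

    no-isolated-edge : ∀ x y → deg x ≡ 1 → deg y ≡ 1 → missing x y ≡ 0
    no-isolated-edge x y dx≡1 dy≡1 with missing x y ≟ 0
    ... | yes ≡0 = ≡0
    ... | no ≢0  = contradiction
      (friend-unique size (leaf-friend ≢0 dx≡1)
        -- Deleting x and y in either order gives the same set, so the leaf y supplies the second
        -- friend x.
        (subst (λ A → Friend (A ⊕ v) x) ([]≔-commutes K y x y≢x)
          (leaf-friend (≢0 ∘ trans (missing-sym x y)) dy≡1)))
      y≢x
      where
      x∈K = proj₁ (missing≢0 ≢0)
      y∈K⊖x = proj₂ (missing≢0 {x} ≢0)
      y≢x = proj₁ (∈-⊖ K x y y∈K⊖x)
      size : ∣ K ⊖ x ⊖ y ⊕ v ∣ ≡ suc k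
      size = trans (∣⊕∣ (K ⊖ x ⊖ y) v (∉-⊖⁺ (K ⊖ x) y v (∉-⊖⁺ K x v v∉K))) (trans (∣⊖∣ (K ⊖ x) y y∈K⊖x) (∣K⊖∣ x∈K))

    total : (X : Fin n → Fin n → ℕ) → ℕ
    total X = ∑ᵥ (λ x → ∑ᵥ (X x))

    total-pair : total pair ≡ suc (suc k) * suc k
    total-pair = begin
      ∑ᵥ (λ x → ∑ᵥ (pair x))
        ≡⟨ ∑-cong (allFin n) (λ x → trans (∑-*ˡ (allFin n) (inn K x) (inn (K ⊖ x)))
             (𝟙-cong (lookup K x) λ x∈K → trans (∑-inn (K ⊖ x)) (∣K⊖∣ x∈K))) ⟩
      ∑ᵥ (λ x → inn K x * suc k)  ≡⟨ ∑-*ʳ (allFin n) (suc k) (inn K) ⟩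
      ∑ᵥ (inn K) * suc k          ≡⟨ cong (_* suc k) (trans (∑-inn K) (proj₁ complete)) ⟩
      suc (suc k) * suc k         ∎

    total-split : total present + total missing ≡ suc (suc k) * suc k
    total-split = begin
      total present + total missing  ≡⟨ ∑-+ (allFin n) _ _ ⟨
      ∑ᵥ (λ x → ∑ᵥ (present x) + ∑ᵥ (missing x))
        ≡⟨ ∑-cong (allFin n) (λ x → trans (sym (∑-+ (allFin n) (present x) (missing x)))
             (∑-cong (allFin n) λ y → trans (sym (*-distribˡ-+ (pair x y) _ _))
               (trans (cong (pair x y *_) (𝟙+𝟙not (isEdge H (K ⊖ x ⊖ y ⊕ v)))) (*-identityʳ _)))) ⟩
      total pair                     ≡⟨ total-pair ⟩
      suc (suc k) * suc k            ∎

    -- `m` is the number of edges of the graph; the inequality is `four-thirds` for r + 1 vertices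
    -- and degree sum 2m, halved.
    missing-count : ∃ λ m → total missing ≡ 2 * m × 2 * suc (suc k) ≤ 3 * m
    missing-count with symmetric-sum-even missing missing-sym missing-irr
    ... | m , eq = m , eq , *-cancelˡ-≤ 2 (subst₂ _≤_ lhs rhs
        (four-thirds deg-outside no-isolated-vertex no-isolated-edge))
      where
      lhs : 4 * ∑ᵥ (inn K) ≡ 2 * (2 * suc (suc k))
      lhs = trans (cong (4 *_) (trans (∑-inn K) (proj₁ complete))) (*-assoc 2 2 (suc (suc k)))
      swap : ∀ m → 3 * (2 * m) ≡ 2 * (3 * m)
      swap = solve-∀
      rhs : 3 * total missing ≡ 2 * (3 * m)
      rhs = trans (cong (3 *_) eq) (swap m)

-- Arithmetic of the two constants

m*n≤o⇒m≤o/n : ∀ m n o .{{_ : NonZero n}} → m * n ≤ o → m ≤ o / n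
m*n≤o⇒m≤o/n m n o le = subst (_≤ o / n) (m*n/n≡m m n) (/-monoˡ-≤ n le)

pronic-even : ∀ k → ∃ λ t → suc k * k ≡ 2 * t
pronic-even zero = 0 , refl
pronic-even (suc k) with pronic-even k
... | t , eq = suc k + t , trans (step k) (trans (cong (2 * suc k +_) eq) (sym (*-distribˡ-+ 2 (suc k) t)))
  where
  step : ∀ k → suc (suc k) * suc k ≡ 2 * suc k + suc k * k
  step = solve-∀

-- Clears denominators in (r + 1)(3r - 4)/6 = r(r + 1)/2 - 2(r + 1)/3; `2 ≤ r` makes the truncated
-- subtraction exact.
floor-numerator : ∀ r → 2 ≤ r → (r + 1) * (3 * r ∸ 4) + 4 * suc r ≡ 3 * (suc r * r)
floor-numerator (suc (suc j)) (s≤s (s≤s z≤n)) =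
  trans (cong (λ z → (2 + j + 1) * z + 4 * suc (2 + j)) (trans (cong (_∸ 4) (shift j)) (m+n∸m≡n 4 (2 + 3 * j))))
        (expand j)
  where
  shift : ∀ j → 3 * (2 + j) ≡ 4 + (2 + 3 * j)
  shift = solve-∀
  expand : ∀ j → (2 + j + 1) * (2 + 3 * j) + 4 * (3 + j) ≡ 3 * ((3 + j) * (2 + j))
  expand = solve-∀

-- Here p counts ordered present pairs and 2m missing ones. As r(r + 1) is even, p = 2a, and 6a =
-- 3r(r + 1) - 6m ≤ (r + 1)(3r - 4); integrality of a yields the floor.
floorTerm-upper : ∀ r p m → 2 ≤ r → p + 2 * m ≡ suc r * r → 2 * suc r ≤ 3 * m → p ≤ 2 * floorTerm r
floorTerm-upper r p m 2≤r split 2r≤3m with pronic-even r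
... | t , pronic = ≤-trans (≤-reflexive p≡2a) (*-monoʳ-≤ 2 (m*n≤o⇒m≤o/n a 6 _
    (+-cancelʳ-≤ (4 * suc r) _ _ (≤-trans (+-monoʳ-≤ (a * 6) 4r≤6m) (≤-reflexive (begin
      a * 6 + 2 * (3 * m)      ≡⟨ collect a m ⟩
      3 * (2 * a + 2 * m)      ≡⟨ cong (3 *_) (trans (cong (_+ 2 * m) (sym p≡2a)) split) ⟩
      3 * (suc r * r)          ≡⟨ floor-numerator r 2≤r ⟨
      (r + 1) * (3 * r ∸ 4) + 4 * suc r  ∎))))))
  where
  a = t ∸ m
  p≡2a : p ≡ 2 * a
  p≡2a = begin
    p                  ≡⟨ m+n∸n≡m p (2 * m) ⟨
    p + 2 * m ∸ 2 * m  ≡⟨ cong (_∸ 2 * m) (trans split pronic) ⟩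
    2 * t ∸ 2 * m      ≡⟨ *-distribˡ-∸ 2 t m ⟨
    2 * a              ∎
  4r≤6m : 4 * suc r ≤ 2 * (3 * m)
  4r≤6m = ≤-trans (≤-reflexive (*-assoc 2 2 (suc r))) (*-monoʳ-≤ 2 2r≤3m)
  collect : ∀ a m → a * 6 + 2 * (3 * m) ≡ 3 * (2 * a + 2 * m)
  collect = solve-∀

-- The 2 added in the numerator covers the largest remainder modulo 3.
ceilTerm-lower : ∀ r → 2 * suc r ≤ 3 * ceilTerm r
ceilTerm-lower r = +-cancelʳ-≤ 2 _ _ (≤-trans
  (≤-reflexive (trans (cong (λ z → 2 * z + 2) (+-comm 1 r)) (m≡m%n+[m/n]*n N 3)))
  (≤-trans (+-monoˡ-≤ (N / 3 * 3) (≤-pred (m%n<n N 3))) (≤-reflexive (swap (N / 3)))))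
  where
  N = 2 * (r + 1) + 2
  swap : ∀ c → 2 + c * 3 ≡ 3 * c + 2
  swap = solve-∀

-- With t = r(r + 1)/2 and c the ceiling, `ceilTerm-lower` gives 6 (t - c) ≤ (r + 1)(3r - 4), so t -
-- c is at most the floor.
floorTerm+ceilTerm : ∀ r → 2 ≤ r → suc r * r ≤ 2 * (floorTerm r + ceilTerm r)
floorTerm+ceilTerm r 2≤r with pronic-even r
... | t , pronic = ≤-trans (≤-reflexive pronic) (*-monoʳ-≤ 2 (≤-trans (m≤n+m∸n t c)
    (≤-trans (≤-reflexive (+-comm c (t ∸ c))) (+-monoˡ-≤ c (m*n≤o⇒m≤o/n (t ∸ c) 6 _ bound)))))
  where
  c = ceilTerm r
  num = (r + 1) * (3 * r ∸ 4)
  assoc : ∀ t → t * 6 ≡ 3 * (2 * t)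
  assoc = solve-∀
  double : ∀ c → c * 6 ≡ 2 * (3 * c)
  double = solve-∀
  bound : (t ∸ c) * 6 ≤ num
  bound = ≤-trans (≤-reflexive (*-distribʳ-∸ 6 t c)) (m≤n+o⇒m∸n≤o (t * 6) (c * 6) (≤-trans
    (≤-reflexive (trans (assoc t) (trans (cong (3 *_) (sym pronic))
      (trans (sym (floor-numerator r 2≤r)) (+-comm num _)))))
    (+-monoˡ-≤ num (≤-trans (≤-reflexive (*-assoc 2 2 (suc r)))
      (≤-trans (*-monoʳ-≤ 2 (ceilTerm-lower r)) (≤-reflexive (sym (double c))))))))

-- Double counting

module Counting {k n : ℕ} (H : Hypergraph (suc k) n) (friendship : IsFriendship H) where

  open FriendshipHypergraph H friendship

  sizeₖ : Subset n → ℕ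
  sizeₖ S = 𝟙 (hasSize k S)

  d : Subset n → ℕ
  d S = ∑ᵥ (λ x → out S x * edge (S ⊕ x))

  q : ℕ
  q = ∑ₛ κ

  degree≡d : ∀ S → ∣ S ∣ ≡ k → degree H S ≡ d S
  degree≡d S refl = trans (degree≡ H S) (∑-⊇-nextSize S edge wrong-size)
    where
    wrong-size : ∀ T → ∣ T ∣ ≢ suc k → edge T ≡ 0
    wrong-size T ∣T∣≢r with isEdge H T in T∈H
    ... | false = refl
    ... | true  = contradiction (uniform H T T∈H) ∣T∣≢r

  -- Counted from above, every hyperedge contributes its r subsets of size r - 1.
  ∑-degree : ∑ₛ (λ S → sizeₖ S * d S) ≡ numEdges H * suc k
  ∑-degree = begin
    ∑ₛ (λ S → sizeₖ S * d S)
      ≡⟨ ∑-cong (allSubsets n) (λ S → trans (sym (∑-*ˡ (allFin n) (sizeₖ S) _))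
           (∑-cong (allFin n) λ x → *-swap (sizeₖ S) (out S x) (edge (S ⊕ x)))) ⟩
    ∑ₛ (λ S → ∑ᵥ λ x → out S x * (sizeₖ S * edge (S ⊕ x)))  ≡⟨ exchange {n} (λ S _ T → sizeₖ S * edge T) ⟩
    ∑ₛ (λ T → ∑ᵥ λ x → inn T x * (sizeₖ (T ⊖ x) * edge T))
      ≡⟨ ∑-cong (allSubsets n) (λ T → trans (∑-cong (allFin n) λ x → simplify T x) (trans
           (∑-*ʳ (allFin n) (edge T) (inn T)) (trans (*-comm (∑ᵥ (inn T)) (edge T))
             (𝟙-cong (isEdge H T) λ T∈H → trans (∑-inn T) (uniform H T T∈H))))) ⟩
    ∑ₛ (λ T → edge T * suc k)                               ≡⟨ ∑-*ʳ (allSubsets n) (suc k) edge ⟩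
    numEdges H * suc k                                      ∎
    where
    simplify : ∀ T x → inn T x * (sizeₖ (T ⊖ x) * edge T) ≡ inn T x * edge T
    simplify T x = 𝟙-cong (lookup T x) λ x∈T → trans (*-comm (sizeₖ (T ⊖ x)) (edge T))
      (trans (𝟙-cong (isEdge H T) λ T∈H → cong 𝟙 (⇒hasSize k (T ⊖ x)
               (suc-injective (trans (∣⊖∣ T x x∈T) (uniform H T T∈H)))))
             (*-identityʳ (edge T)))

  -- By `completions` every hyperedge lies in exactly one complete set, and a complete set contains
  -- r + 1 hyperedges.
  numEdges≡ : numEdges H ≡ q * suc (suc k)
  numEdges≡ = begin
    ∑ₛ edge
      ≡⟨ ∑-cong (allSubsets n) (λ T → trans (sym (*-identityʳ (edge T))) (trans (𝟙-cong (isEdge H T) λ T∈H →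
           sym (cong 𝟙 (⇒hasSize (suc k) T (uniform H T T∈H)))) (trans (*-comm (edge T) _)
             (𝟙-cong (hasSize (suc k) T) λ h → sym (completions T (hasSize⇒ (suc k) T h)))))) ⟩
    ∑ₛ (λ T → 𝟙 (hasSize (suc k) T) * ∑ᵥ (λ y → out T y * κ (T ⊕ y)))
      ≡⟨ ∑-cong (allSubsets n) (λ T → trans (sym (∑-*ˡ (allFin n) (𝟙 (hasSize (suc k) T)) _))
           (∑-cong (allFin n) λ y → *-swap (𝟙 (hasSize (suc k) T)) (out T y) (κ (T ⊕ y)))) ⟩
    ∑ₛ (λ T → ∑ᵥ λ y → out T y * (𝟙 (hasSize (suc k) T) * κ (T ⊕ y)))
      ≡⟨ exchange {n} (λ T _ K → 𝟙 (hasSize (suc k) T) * κ K) ⟩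
    ∑ₛ (λ K → ∑ᵥ λ y → inn K y * (𝟙 (hasSize (suc k) (K ⊖ y)) * κ K))
      ≡⟨ ∑-cong (allSubsets n) (λ K → trans (∑-cong (allFin n) λ y → simplify K y) (trans
           (∑-*ʳ (allFin n) (κ K) (inn K)) (trans (*-comm (∑ᵥ (inn K)) (κ K))
             (𝟙-cong (completeᵇ K) λ c → trans (∑-inn K) (proj₁ (completeᵇ⇒ K c)))))) ⟩
    ∑ₛ (λ K → κ K * suc (suc k))  ≡⟨ ∑-*ʳ (allSubsets n) (suc (suc k)) κ ⟩
    q * suc (suc k)               ∎
    where
    simplify : ∀ K y → inn K y * (𝟙 (hasSize (suc k) (K ⊖ y)) * κ K) ≡ inn K y * κ K
    simplify K y = 𝟙-cong (lookup K y) λ y∈K → trans (*-comm (𝟙 (hasSize (suc k) (K ⊖ y))) (κ K))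
      (trans (𝟙-cong (completeᵇ K) λ c → cong 𝟙 (⇒hasSize (suc k) (K ⊖ y)
               (suc-injective (trans (∣⊖∣ K y y∈K) (proj₁ (completeᵇ⇒ K c))))))
             (*-identityʳ (κ K)))

  -- The second moment of the degrees

  escaping : Subset n → Subset n → ℕ
  escaping S K = ∑ᵥ (λ v → out K v * edge (S ⊕ v))

  -- Each K arises twice, once per order of the two added vertices, matching the ordered pairs
  -- behind `present`.
  extensions : (Subset n → ℕ) → Subset n → ℕ
  extensions f S = ∑ᵥ (λ x → out S x * ∑ᵥ (λ y → out (S ⊕ x) y * f (S ⊕ x ⊕ y)))

  extensions-κ : ∀ S → ∣ S ∣ ≡ k → extensions κ S ≡ d S
  extensions-κ S ∣S∣≡k = ∑-cong (allFin n) λ x → 𝟙-cong (not (lookup S x)) λ x∉S →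
    completions (S ⊕ x) (trans (∣⊕∣ S x (not-true x∉S)) (cong suc ∣S∣≡k))

  -- S + x and S + y are faces of the complete set and account for the 2; any other vertex counted
  -- by d(S) lies outside K.
  d-split : ∀ S x y → lookup S x ≡ false → lookup (S ⊕ x) y ≡ false → Complete (S ⊕ x ⊕ y) →
            d S ≡ 2 + escaping S (S ⊕ x ⊕ y)
  d-split S x y x∉S y∉S⊕x (_ , faces) = begin
    d S                                                ≡⟨ ∑ᵥ-remove S x (λ v → edge (S ⊕ v)) x∉S ⟩
    edge (S ⊕ x) + escaping S (S ⊕ x)
      ≡⟨ cong (edge (S ⊕ x) +_) (∑ᵥ-remove (S ⊕ x) y (λ v → edge (S ⊕ v)) y∉S⊕x) ⟩
    edge (S ⊕ x) + (edge (S ⊕ y) + escaping S (S ⊕ x ⊕ y))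
      ≡⟨ cong₂ (λ a b → 𝟙 a + (𝟙 b + escaping S (S ⊕ x ⊕ y))) ex ey ⟩
    2 + escaping S (S ⊕ x ⊕ y)                         ∎
    where
    x≢y : x ≢ y
    x≢y = ∈∉⇒≢ (S ⊕ x) (lookup∘update x S true) y∉S⊕x
    ex : isEdge H (S ⊕ x) ≡ true
    ex = trans (cong (isEdge H) (sym (⊕⊖ (S ⊕ x) y y∉S⊕x))) (faces y (lookup∘update y (S ⊕ x) true))
    x∉S⊕y : lookup (S ⊕ y) x ≡ false
    x∉S⊕y = trans (lookup∘update′ x≢y S true) x∉S
    ey : isEdge H (S ⊕ y) ≡ true
    ey = trans (cong (isEdge H) (sym (trans (cong (_⊖ x) ([]≔-commutes S x y x≢y)) (⊕⊖ (S ⊕ y) x x∉S⊕y))))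
               (faces x (∈-⊕ (S ⊕ x) y x (lookup∘update x S true)))

  extensions-cong : ∀ S (f g : Subset n → ℕ) →
    (∀ x y → lookup S x ≡ false → lookup (S ⊕ x) y ≡ false → f (S ⊕ x ⊕ y) ≡ g (S ⊕ x ⊕ y)) →
    extensions f S ≡ extensions g S
  extensions-cong S f g f≗g = ∑-cong (allFin n) λ x → 𝟙-cong (not (lookup S x)) λ x∉S →
    ∑-cong (allFin n) λ y → 𝟙-cong (not (lookup (S ⊕ x) y)) λ y∉ → f≗g x y (not-true x∉S) (not-true y∉)

  extensions-+ : ∀ S f g → extensions (λ K → f K + g K) S ≡ extensions f S + extensions g S
  extensions-+ S f g = trans (∑-cong (allFin n) λ x → trans (cong (out S x *_) (trans (∑-cong (allFin n) λ y →
      *-distribˡ-+ (out (S ⊕ x) y) _ _) (∑-+ (allFin n) _ _))) (*-distribˡ-+ (out S x) _ _)) (∑-+ (allFin n) _ _)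

  extensions-*ʳ : ∀ S f c → extensions (λ K → f K * c) S ≡ extensions f S * c
  extensions-*ʳ S f c = trans (∑-cong (allFin n) λ x → trans (cong (out S x *_) (trans (∑-cong (allFin n) λ y →
      sym (*-assoc (out (S ⊕ x) y) _ c)) (∑-*ʳ (allFin n) c _))) (sym (*-assoc (out S x) _ c))) (∑-*ʳ (allFin n) c _)

  -- One factor is expanded over the hyperedges S + x, each with its unique complete set K = S + x +
  -- y; there `d-split` rewrites the other factor.
  d² : ∀ S → ∣ S ∣ ≡ k → d S * d S ≡ d S * 2 + extensions (λ K → κ K * escaping S K) S
  d² S ∣S∣≡k = begin
    d S * d S                                ≡⟨ cong (_* d S) (extensions-κ S ∣S∣≡k) ⟨
    extensions κ S * d S                     ≡⟨ extensions-*ʳ S κ (d S) ⟨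
    extensions (λ K → κ K * d S) S
      ≡⟨ extensions-cong S (λ K → κ K * d S) (λ K → κ K * 2 + κ K * escaping S K)
           (λ x y x∉S y∉ → trans (𝟙-cong (completeᵇ (S ⊕ x ⊕ y)) λ c →
           d-split S x y x∉S y∉ (completeᵇ⇒ _ c)) (*-distribˡ-+ (κ (S ⊕ x ⊕ y)) 2 _)) ⟩
    extensions (λ K → κ K * 2 + κ K * escaping S K) S
      ≡⟨ extensions-+ S (λ K → κ K * 2) (λ K → κ K * escaping S K) ⟩
    extensions (λ K → κ K * 2) S + cross     ≡⟨ cong (_+ cross) (extensions-*ʳ S κ 2) ⟩
    extensions κ S * 2 + cross               ≡⟨ cong (λ z → z * 2 + cross) (extensions-κ S ∣S∣≡k) ⟩
    d S * 2 + cross                          ∎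
    where
    cross = extensions (λ K → κ K * escaping S K) S

  -- `exchange` is applied twice. In between, the sums over x and y are interchanged, so that y,
  -- added last, can be removed from K first.
  extensions-exchange : ∀ (f : Subset n → Subset n → ℕ) →
    ∑ₛ (λ S → extensions (f S) S) ≡ ∑ₛ (λ K → ∑ᵥ λ y → inn K y * ∑ᵥ λ x → inn (K ⊖ y) x * f (K ⊖ y ⊖ x) K)
  extensions-exchange f = begin
    ∑ₛ (λ S → extensions (f S) S)
      ≡⟨ exchange {n} (λ S _ T → ∑ᵥ λ y → out T y * f S (T ⊕ y)) ⟩
    ∑ₛ (λ T → ∑ᵥ λ x → inn T x * ∑ᵥ λ y → out T y * f (T ⊖ x) (T ⊕ y))
      ≡⟨ ∑-cong (allSubsets n) (λ T → begin
           ∑ᵥ (λ x → inn T x * ∑ᵥ λ y → out T y * f (T ⊖ x) (T ⊕ y))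
             ≡⟨ ∑-cong (allFin n) (λ x → sym (∑-*ˡ (allFin n) (inn T x) _)) ⟩
           ∑ᵥ (λ x → ∑ᵥ λ y → inn T x * (out T y * f (T ⊖ x) (T ⊕ y)))  ≡⟨ ∑-swap (allFin n) (allFin n) _ ⟩
           ∑ᵥ (λ y → ∑ᵥ λ x → inn T x * (out T y * f (T ⊖ x) (T ⊕ y)))
             ≡⟨ ∑-cong (allFin n) (λ y → trans (∑-cong (allFin n) λ x → *-swap (inn T x) (out T y) _)
                  (∑-*ˡ (allFin n) (out T y) _)) ⟩
           ∑ᵥ (λ y → out T y * ∑ᵥ λ x → inn T x * f (T ⊖ x) (T ⊕ y))  ∎) ⟩
    ∑ₛ (λ T → ∑ᵥ λ y → out T y * ∑ᵥ λ x → inn T x * f (T ⊖ x) (T ⊕ y))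
      ≡⟨ exchange {n} (λ T _ K → ∑ᵥ λ x → inn T x * f (T ⊖ x) K) ⟩
    ∑ₛ (λ K → ∑ᵥ λ y → inn K y * ∑ᵥ λ x → inn (K ⊖ y) x * f (K ⊖ y ⊖ x) K)  ∎


  module _ (2≤r : 2 ≤ suc k) {m : ℕ} (n≡ : suc (suc k) + m ≡ n) where

    F : ℕ
    F = floorTerm (suc k)

    present-bound : ∀ {K} (c : Complete K) {v} (v∉K : lookup K v ≡ false) →
      ∑ᵥ (λ y → ∑ᵥ λ x → inn K y * inn (K ⊖ y) x * edge (K ⊖ y ⊖ x ⊕ v)) ≤ 2 * F
    present-bound c v∉K with missing-count
      where open Outside c v∉K
    ... | μ , eq , le = floorTerm-upper (suc k) _ μ 2≤r (trans (cong (total present +_) (sym eq)) total-split) le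
      where open Outside c v∉K

    -- Summing over v first leaves, for each of the m vertices outside K, a count of present pairs.
    escaping-bound : ∀ K → Complete K →
      ∑ᵥ (λ y → inn K y * ∑ᵥ λ x → inn (K ⊖ y) x * escaping (K ⊖ y ⊖ x) K) ≤ m * (2 * F)
    escaping-bound K c = ≤-trans (≤-reflexive reorder) (≤-trans
      (∑-mono (allFin n) λ v → 𝟙-mono (not (lookup K v)) λ v∉K → present-bound c (not-true v∉K))
      (≤-reflexive (trans (∑-*ʳ (allFin n) (2 * F) (out K)) (cong (_* (2 * F)) ∣outside∣))))
      where
      ∣outside∣ : ∑ᵥ (out K) ≡ m
      ∣outside∣ = +-cancelˡ-≡ (suc (suc k)) _ _
        (trans (cong (_+ ∑ᵥ (out K)) (sym (proj₁ c))) (trans (∑-out K) (sym n≡)))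
      move : ∀ a b c e → a * (b * (c * e)) ≡ c * (a * b * e)
      move = solve-∀
      reorder : ∑ᵥ (λ y → inn K y * ∑ᵥ λ x → inn (K ⊖ y) x * escaping (K ⊖ y ⊖ x) K) ≡
                ∑ᵥ (λ v → out K v * ∑ᵥ (λ y → ∑ᵥ λ x → inn K y * inn (K ⊖ y) x * edge (K ⊖ y ⊖ x ⊕ v)))
      reorder = begin
        ∑ᵥ (λ y → inn K y * ∑ᵥ λ x → inn (K ⊖ y) x * escaping (K ⊖ y ⊖ x) K)
          ≡⟨ ∑-cong (allFin n) (λ y → trans (sym (∑-*ˡ (allFin n) (inn K y) _)) (trans (∑-cong (allFin n) λ x →
               trans (cong (inn K y *_) (sym (∑-*ˡ (allFin n) (inn (K ⊖ y) x) _)))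
                 (trans (sym (∑-*ˡ (allFin n) (inn K y) _)) (∑-cong (allFin n) λ v →
                   move (inn K y) (inn (K ⊖ y) x) (out K v) (edge (K ⊖ y ⊖ x ⊕ v)))))
               (∑-swap (allFin n) (allFin n) _))) ⟩
        ∑ᵥ (λ y → ∑ᵥ λ v → ∑ᵥ λ x → out K v * (inn K y * inn (K ⊖ y) x * edge (K ⊖ y ⊖ x ⊕ v)))
          ≡⟨ ∑-swap (allFin n) (allFin n) _ ⟩
        ∑ᵥ (λ v → ∑ᵥ λ y → ∑ᵥ λ x → out K v * (inn K y * inn (K ⊖ y) x * edge (K ⊖ y ⊖ x ⊕ v)))
          ≡⟨ ∑-cong (allFin n) (λ v → trans (∑-cong (allFin n) λ y → ∑-*ˡ (allFin n) (out K v) _)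
               (∑-*ˡ (allFin n) (out K v) _)) ⟩
        ∑ᵥ (λ v → out K v * ∑ᵥ (λ y → ∑ᵥ λ x → inn K y * inn (K ⊖ y) x * edge (K ⊖ y ⊖ x ⊕ v)))  ∎

    cross-bound : ∑ₛ (λ S → extensions (λ K → κ K * escaping S K) S) ≤ q * (m * (2 * F))
    cross-bound = ≤-trans (≤-reflexive (trans (extensions-exchange λ S K → κ K * escaping S K)
        (∑-cong (allSubsets n) pull)))
      (≤-trans (∑-mono (allSubsets n) λ K → 𝟙-mono (completeᵇ K) λ c → escaping-bound K (completeᵇ⇒ K c))
        (≤-reflexive (∑-*ʳ (allSubsets n) (m * (2 * F)) κ)))
      where
      pull : ∀ K → ∑ᵥ (λ y → inn K y * ∑ᵥ λ x → inn (K ⊖ y) x * (κ K * escaping (K ⊖ y ⊖ x) K)) ≡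
                   κ K * ∑ᵥ (λ y → inn K y * ∑ᵥ λ x → inn (K ⊖ y) x * escaping (K ⊖ y ⊖ x) K)
      pull K = trans (∑-cong (allFin n) λ y → trans (cong (inn K y *_) (trans (∑-cong (allFin n) λ x →
          *-swap (inn (K ⊖ y) x) (κ K) _) (∑-*ˡ (allFin n) (κ K) _))) (*-swap (inn K y) (κ K) _))
        (∑-*ˡ (allFin n) (κ K) _)

    open CauchySchwarz (allSubsets n) sizeₖ d public

    second-bound : second ≤ first * 2 + q * (m * (2 * F))
    second-bound = ≤-trans (∑-mono (allSubsets n) pointwise) (≤-trans (≤-reflexive (∑-+ (allSubsets n) _ _))
      (+-mono-≤ (≤-reflexive (∑-*ʳ (allSubsets n) 2 _)) cross-bound))
      where
      pointwise : ∀ S → sizeₖ S * (d S * d S) ≤ sizeₖ S * d S * 2 + extensions (λ K → κ K * escaping S K) S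
      pointwise S = ≤-trans (≤-reflexive (trans (𝟙-cong (hasSize k S) λ h → d² S (hasSize⇒ k S h))
          (trans (*-distribˡ-+ (sizeₖ S) (d S * 2) _)
            (cong (_+ sizeₖ S * extensions (λ K → κ K * escaping S K) S) (sym (*-assoc (sizeₖ S) (d S) 2))))))
        -- Dropping the size weight can only enlarge the cross term.
        (+-monoʳ-≤ (sizeₖ S * d S * 2) (𝟙*x≤x (hasSize k S) _))

    -- The bound on the number of hyperedges and the case of equality

    bound : ℕ
    bound = 2 * suc k * F * (n C suc k) + 4 * ceilTerm (suc k) * (n C k)

    -- The theorem compares this with `bound`: both sides are multiplied by r²(r + 1) to clear
    -- fractions.
    weighted : ℕ
    weighted = suc k * suc k * (suc k + 1) * numEdges H

    -- The extra factor r + 1 lets q (r + 1) become |E| in `mass*second≤`, so that |E| can be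
    -- cancelled from both ends of the chain.
    first² : suc (suc k) * (first * first) ≡ numEdges H * weighted
    first² = trans (cong (λ z → suc (suc k) * (z * z)) ∑-degree) (expand (suc k) (numEdges H))
      where
      expand : ∀ r e → suc r * (e * r * (e * r)) ≡ e * (r * r * (r + 1) * e)
      expand = solve-∀

    mass*second≤ : suc (suc k) * (mass * second) ≤ numEdges H * bound
    mass*second≤ = ≤-trans (*-monoʳ-≤ (suc r) (*-monoʳ-≤ mass second-bound)) (≤-trans (≤-reflexive (begin
      suc r * (mass * (first * 2 + q * (m * (2 * F))))
        ≡⟨ cong (λ z → suc r * (mass * (z * 2 + q * (m * (2 * F))))) ∑-degree ⟩
      suc r * (mass * (e * r * 2 + q * (m * (2 * F))))  ≡⟨ expand r mass e q m F ⟩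
      mass * (2 * e * (suc r * r) + q * suc r * (2 * (m * F)))
        ≡⟨ cong (λ z → mass * (2 * e * (suc r * r) + z * (2 * (m * F)))) numEdges≡ ⟨
      mass * (2 * e * (suc r * r) + e * (2 * (m * F)))  ∎))
      -- Replacing r(r + 1) by 2 (F + c) joins the linear term to the term in m, giving the factor m
      -- + 2.
      (≤-trans (*-monoʳ-≤ mass (+-monoˡ-≤ _ (*-monoʳ-≤ (2 * e) (floorTerm+ceilTerm r 2≤r)))) (≤-reflexive (begin
      mass * (2 * e * (2 * (F + c)) + e * (2 * (m * F)))  ≡⟨ regroup mass e F c m ⟩
      e * (2 * F * (mass * suc (suc m)) + 4 * c * mass)
        ≡⟨ cong (λ M → e * (2 * F * (M * suc (suc m)) + 4 * c * M)) (∑-hasSize n k) ⟩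
      e * (2 * F * ((n C k) * suc (suc m)) + 4 * c * (n C k))
        -- Since n - (r - 1) = m + 2, `binomial-step` turns the product into r times the binomial
        -- coefficient of n over r.
        ≡⟨ cong (λ z → e * (2 * F * z + 4 * c * (n C k))) (binomial-step k (suc m) (trans (+-suc (suc k) m) n≡)) ⟨
      e * (2 * F * ((n C suc k) * r) + 4 * c * (n C k))
        ≡⟨ cong (λ z → e * (z + 4 * c * (n C k))) (reorder F (n C suc k) r) ⟩
      e * bound  ∎))))
      where
      r = suc k
      e = numEdges H
      c = ceilTerm r
      expand : ∀ r M e q m F → suc r * (M * (e * r * 2 + q * (m * (2 * F)))) ≡
                               M * (2 * e * (suc r * r) + q * suc r * (2 * (m * F)))
      expand = solve-∀
      regroup : ∀ M e F c m → M * (2 * e * (2 * (F + c)) + e * (2 * (m * F))) ≡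
                              e * (2 * F * (M * suc (suc m)) + 4 * c * M)
      regroup = solve-∀
      reorder : ∀ F C r → 2 * F * (C * r) ≡ 2 * r * F * C
      reorder = solve-∀

    -- The common factor |E| is cancelled, unless it is zero and the left side vanishes.
    weighted≤bound : weighted ≤ bound
    weighted≤bound with numEdges H in eq
    ... | zero  = ≤-trans (≤-reflexive (*-zeroʳ (suc k * suc k * (suc k + 1)))) z≤n
    ... | suc e = *-cancelˡ-≤ (suc e) (subst (λ z → z * (suc k * suc k * (suc k + 1) * z) ≤ z * bound) eq
      (≤-trans (≤-reflexive (sym first²)) (≤-trans (*-monoʳ-≤ (suc (suc k)) cauchy-schwarz) mass*second≤)))

    -- Equality closes the chain through `first²` and `mass*second≤`, so Cauchy-Schwarz is tight and
    -- all sets of weight one share a degree.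
    degree-constant : weighted ≡ bound → ∀ S T → ∣ S ∣ ≡ k → ∣ T ∣ ≡ k → degree H S ≡ degree H T
    degree-constant tight S T ∣S∣≡k ∣T∣≡k = trans (degree≡d S ∣S∣≡k) (trans
      (cauchy-schwarz-tight (*-cancelˡ-≤ (suc (suc k)) (≤-trans mass*second≤
          (≤-reflexive (trans (cong (numEdges H *_) (sym tight)) (sym first²)))))
        (∈-allSubsets S) (∈-allSubsets T) (cong 𝟙 (⇒hasSize k S ∣S∣≡k)) (cong 𝟙 (⇒hasSize k T ∣T∣≡k)))
      (sym (degree≡d T ∣T∣≡k)))

theorem2 : (r n : ℕ) → 3 ≤ r → r + 1 ≤ n → (H : Hypergraph r n) → IsFriendship H →
    (r * r * (r + 1) * numEdges H
    ≤ 2 * r * floorTerm r * (n C r) + 4 * ceilTerm r * (n C (r ∸ 1)))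
    × (r * r * (r + 1) * numEdges H
    ≡ 2 * r * floorTerm r * (n C r) + 4 * ceilTerm r * (n C (r ∸ 1)) →
    Σ ℕ (λ d → ∀ (S : Subset n) → ∣ S ∣ ≡ r ∸ 1 → degree H S ≡ d))
theorem2 (suc k) n 3≤r r+1≤n H friendship =
  weighted≤bound 2≤r n≡ , λ tight → degree H S₀ , λ S ∣S∣≡k → degree-constant 2≤r n≡ tight S S₀ ∣S∣≡k ∣S₀∣≡k
  where
  open Counting H friendship
  2≤r = ≤-trans (n≤1+n 2) 3≤r
  r<n : suc (suc k) ≤ n
  r<n = subst (_≤ n) (+-comm (suc k) 1) r+1≤n
  n≡ : suc (suc k) + (n ∸ suc (suc k)) ≡ n
  n≡ = m+[n∸m]≡n r<n
  -- An (r - 1)-set exists because n ≥ r + 1; its degree serves as the common value.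
  S₀ = proj₁ (∃-size {k} {n} (≤-trans (≤-trans (n≤1+n k) (n≤1+n (suc k))) r<n))
  ∣S₀∣≡k = proj₂ (∃-size {k} {n} (≤-trans (≤-trans (n≤1+n k) (n≤1+n (suc k))) r<n))
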